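{- Let $\mathcal{U}$ be a finite universe with $u=|\mathcal{U}|\ge 2$, let $\mathcal{P}=(p_x)_{x\in\mathcal{U}}$ and $\mathcal{Q}=(q_x)_{x\in\mathcal{U}}$ be probability distributions on $\mathcal{U}$, let $n\ge 1$ be an integer and $0<\varepsilon<1$. Let $\mathcal{T}\subseteq 2^{\mathcal{U}}$ be a family of subsets of $\mathcal{U}$ such that $$\Pr_{S\sim\mathcal{P}_n}[S\notin\mathcal{T}]\le \frac{1}{\log u}.$$ Let $A$ be an algorithm such that for all $S\in\mathcal{T}$, $A(S)$ is a $(\mathcal{Q},\varepsilon)$-filter for $S$. Then the expected size of $A(S)$ must satisfy $$\mathbb{E}_{\mathcal{P}_n,A}\big[|A(S)|\big]\ \ge\ \mathrm{LB}(\mathcal{P}_n,\mathcal{Q},\varepsilon)-1-6n ,$$ where $S$ is sampled with respect to $\mathcal{P}_n$.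
   Context: $\log$ denotes $\log_2$. $S\sim\mathcal{P}_n$ means that $n$ elements are drawn independently with replacement from $\mathcal{P}$ and $S$ is the set of distinct elements drawn. The (randomized) algorithm $A$ takes a set $S\subseteq\mathcal{U}$ and outputs a data structure instance $\mathcal{I}=A(S)$. Each instance $\mathcal{I}$ corresponds to the subset $\mathcal{U}_{\mathcal{I}}\subseteq\mathcal{U}$ of elements on which the data structure answers YES to membership queries, and $|\mathcal{I}|$ denotes the number of bits needed by the instance. $\mathbb{E}_{\mathcal{P}_n,A}$ is the expectation over both the random input set and the internal randomness of $A$. $A(S)$ is a $(\mathcal{Q},\varepsilon)$-filter for $S$ if (1) every $x\in S$ is answered YES with probability $1$; and (2) $\sum_{x\in\mathcal{U}\setminus S} q_x\cdot\Pr_A[A(S)\text{ answers YES on }x]\le\varepsilon$, the probability being over the internal randomness of $A$ only. For $x\in\mathcal{U}$ define $$k_x=\begin{cases}0 & \text{if } p_x>1/n \text{ or } q_x\le\varepsilon p_x,\\ \log\!\big(\tfrac1\varepsilon\cdot\tfrac{q_x}{p_x}\big) & \text{if } \varepsilon p_x<q_x\le\min\{p_x,\varepsilon/n\},\\ \log(1/\varepsilon) & \text{if } q_x>p_x \text{ and } p_x\le\varepsilon/n,\\ \log(1/(np_x)) & \text{if } q_x>\varepsilon/n \text{ and } \varepsilon/n<p_x\le 1/n,\end{cases}$$ and $\mathrm{LB}(\mathcal{P}_n,\mathcal{Q},\varepsilon)=n\sum_{x\in\mathcal{U}}p_xk_x$.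
   Formalization: The number of bits |I| is read as the length of a bit string that determines the set answered YES, and the strings A can output are required to form a prefix-free (self-delimiting) code; for arbitrary bit strings the stated bound fails. -}

module Defs where

open import Algebra.Bundles using (CommutativeRing)
open import Data.Bool.Base using (Bool; true; false; if_then_else_)
open import Data.Fin.Base using (Fin)
open import Data.Fin.Subset using (Subset; ⁅_⁆; ⋃; _∈_)
open import Data.Fin.Subset.Properties using (_∈?_)
open import Data.List.Base as List using (List; []; _∷_; length; allFin; cartesianProductWith)
open import Data.List.Relation.Binary.Prefix.Heterogeneous using (Prefix)
open import Data.List.Relation.Unary.Unique.Propositional using (Unique)
open import Data.Nat.Base as ℕ using (ℕ; zero; suc)
open import Data.Product.Base using (∃; _×_; _,_)
open import Data.Vec.Base as Vec using (Vec; []; _∷_)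
open import Level using (0ℓ) renaming (suc to lsuc)
open import Relation.Binary.Bundles using (DecTotalOrder; StrictTotalOrder; TotalOrder)
open import Relation.Binary.Core using (Rel)
open import Relation.Binary.PropositionalEquality.Core using (_≡_)
open import Relation.Binary.Structures using (IsDecTotalOrder)
open import Relation.Nullary.Decidable.Core using (does; ¬?; _×-dec_; _⊎-dec_)
open import Relation.Nullary.Negation.Core using (¬_)
open import Relation.Unary using (Pred; Decidable)

import Algebra.Construct.NaturalChoice.Min as Min
import Algebra.Definitions.RawMonoid as RawMonoid
import Relation.Binary.Properties.DecTotalOrder as DecTotalOrderProperties

-- The real numbers, in the classical sense: a Dedekind-complete ordered field.
-- These axioms determine the structure up to unique isomorphism.  The inverse
-- is total, and its value at 0 is unspecified.
record CompleteOrderedField : Set₁ where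
  field
    commutativeRing : CommutativeRing 0ℓ 0ℓ
  open CommutativeRing commutativeRing public
  infix 8 _⁻¹
  infix 4 _≤_
  field
    _⁻¹       : Carrier → Carrier
    ⁻¹-cong   : ∀ {x y} → x ≈ y → x ⁻¹ ≈ y ⁻¹
    *-inverse : ∀ x → ¬ (x ≈ 0#) → x * x ⁻¹ ≈ 1#
    0≉1       : ¬ (0# ≈ 1#)

    _≤_             : Rel Carrier 0ℓ
    isDecTotalOrder : IsDecTotalOrder _≈_ _≤_
    +-mono-≤        : ∀ {x y} z → x ≤ y → x + z ≤ y + z
    *-nonneg        : ∀ {x y} → 0# ≤ x → 0# ≤ y → 0# ≤ x * y

  _isUpperBoundOf_ : Carrier → Pred Carrier 0ℓ → Set
  b isUpperBoundOf P = ∀ x → P x → x ≤ b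

  _isSupremumOf_ : Carrier → Pred Carrier 0ℓ → Set
  s isSupremumOf P = s isUpperBoundOf P × (∀ b → b isUpperBoundOf P → s ≤ b)

  field
    complete : (P : Pred Carrier 0ℓ) → ∃ P → ∃ (_isUpperBoundOf P) → ∃ (_isSupremumOf P)

  decTotalOrder : DecTotalOrder 0ℓ 0ℓ 0ℓ
  decTotalOrder = record { isDecTotalOrder = isDecTotalOrder }

  open DecTotalOrder decTotalOrder public using (_≤?_; totalOrder)
  open DecTotalOrderProperties decTotalOrder public using (_<_; <-strictTotalOrder)
  open StrictTotalOrder <-strictTotalOrder public using (_<?_)
  open Min totalOrder public using (_⊓_)
  open RawMonoid +-rawMonoid public using (sum) renaming (_×_ to _·_)

  infixl 7 _/_
  _/_ : Carrier → Carrier → Carrier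
  x / y = x * y ⁻¹

  fromℕ : ℕ → Carrier
  fromℕ n = n · 1#

-- On positive arguments log₂ is the unique function with these properties; its
-- values elsewhere are unspecified.
record BinaryLogarithm (R : CompleteOrderedField) : Set where
  open CompleteOrderedField R
  field
    log      : Carrier → Carrier
    log-mono : ∀ {x y} → 0# < x → x ≤ y → log x ≤ log y
    log-*    : ∀ {x y} → 0# < x → 0# < y → log (x * y) ≈ log x + log y
    log-2    : log (1# + 1#) ≈ 1#

module Filters (R : CompleteOrderedField) (logarithm : BinaryLogarithm R) where
  open CompleteOrderedField R
  open BinaryLogarithm logarithm public using (log)

  infix 5 _when_
  _when_ : Carrier → Bool → Carrier
  x when b = if b then x else 0#

  sumOver : {X : Set} → (X → Carrier) → List X → Carrier
  sumOver f xs = List.foldr _+_ 0# (List.map f xs)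

  -- s is the (possibly infinite) sum of f over all of X.  Only used for
  -- nonnegative f, where that sum is the supremum of the finite partial sums.
  IsSum : {X : Set} → (X → Carrier) → Carrier → Set
  IsSum f s = s isSupremumOf (λ t → ∃ λ xs → Unique xs × t ≈ sumOver f xs)

  record Distribution (u : ℕ) : Set where
    field
      mass   : Fin u → Carrier
      nonneg : ∀ x → 0# ≤ mass x
      total  : sum mass ≈ 1#

  -- Probability distributions on bit strings.  The set of strings is countable,
  -- so the law of any random string, whatever its source of randomness, is one.
  record StringDistribution : Set where
    field
      mass   : List Bool → Carrier
      nonneg : ∀ I → 0# ≤ mass I
      total  : IsSum mass 1#

  IsProbability : StringDistribution → (List Bool → Bool) → Carrier → Set
  IsProbability D E r = IsSum (λ I → StringDistribution.mass D I when E I) r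

  -- An instance I is the bit string storing it, so |I| is its length, and
  -- accepts I is the set U_I of elements answered YES.  "Bits needed" is read as
  -- for self-delimiting representations: the instances that can be output form a
  -- prefix-free code.  (If the end of the string carried information for free,
  -- the lower bound would fail.)
  record Algorithm (u : ℕ) : Set where
    field
      accepts    : List Bool → Subset u
      output     : Subset u → StringDistribution
      prefixFree : ∀ S S′ I J →
                   0# < StringDistribution.mass (output S) I →
                   0# < StringDistribution.mass (output S′) J →
                   Prefix _≡_ I J → I ≡ J

  module _ {u : ℕ} where

    drawSequences : ∀ n → List (Vec (Fin u) n)
    drawSequences zero    = [] ∷ []
    drawSequences (suc n) = cartesianProductWith _∷_ (allFin u) (drawSequences n)

    weight : Distribution u → ∀ {n} → Vec (Fin u) n → Carrier
    weight 𝒫 v = Vec.foldr _ _*_ 1# (Vec.map (Distribution.mass 𝒫) v)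

    distinct : ∀ {n} → Vec (Fin u) n → Subset u
    distinct v = ⋃ (List.map ⁅_⁆ (Vec.toList v))

    -- Pr_{S ∼ 𝒫ₙ} [ S ∉ T ]
    prOutside : Distribution u → ℕ → {T : Pred (Subset u) 0ℓ} → Decidable T → Carrier
    prOutside 𝒫 n T? =
      sumOver (λ v → weight 𝒫 v when does (¬? (T? (distinct v)))) (drawSequences n)

    -- The probabilities Pr_A [ A(S) answers YES on x ] always exist, by
    -- completeness, and are unique; pr x names them.
    IsFilter : Distribution u → Carrier → Algorithm u → Subset u → Set
    IsFilter 𝒬 ε A S =
      (∀ x → x ∈ S → IsProbability (output S) (yes-on x) 1#) ×
      (∃ λ (pr : Fin u → Carrier) →
        (∀ x → IsProbability (output S) (yes-on x) (pr x)) ×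
        sum (λ x → Distribution.mass 𝒬 x * pr x when does (¬? (x ∈? S))) ≤ ε)
      where
      open Algorithm A
      yes-on : Fin u → List Bool → Bool
      yes-on x I = does (x ∈? accepts I)

    -- e = E_{𝒫ₙ,A} [ |A(S)| ], as a sum over the joint outcomes (draws, instance).
    -- There is no such e exactly when the expectation is infinite.
    IsExpectedSize : Distribution u → ℕ → Algorithm u → Carrier → Set
    IsExpectedSize 𝒫 n A e = IsSum size e
      where
      open Algorithm A
      size : Vec (Fin u) n × List Bool → Carrier
      size (v , I) =
        weight 𝒫 v * (StringDistribution.mass (output (distinct v)) I * fromℕ (length I))

    module _ (𝒫 : Distribution u) (n : ℕ) (𝒬 : Distribution u) (ε : Carrier) where
      open Distribution 𝒫 renaming (mass to p) using ()
      open Distribution 𝒬 renaming (mass to q) using ()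

      -- For n ≥ 1 and 0 < ε < 1 the four cases are exhaustive and mutually
      -- exclusive, so the last branch is never reached.
      k : Fin u → Carrier
      k x =
        if does (1# / N <? p x ⊎-dec q x ≤? ε * p x)
          then 0#
        else if does (ε * p x <? q x ×-dec q x ≤? p x ⊓ (ε / N))
          then log (1# / ε * (q x / p x))
        else if does (p x <? q x ×-dec p x ≤? ε / N)
          then log (1# / ε)
        else if does (ε / N <? q x ×-dec (ε / N <? p x ×-dec p x ≤? 1# / N))
          then log (1# / (N * p x))
        else 0#
        where
        N : Carrier
        N = fromℕ n

      LB : Carrier
      LB = fromℕ n * sum (λ x → p x * k x)

{-# OPTIONS --safe #-}
-- Write k_x = log r_x, so that r_x = 1, or n p_x r_x ≤ 1 and ε p_x r_x ≤ q_x.  Put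
-- z_x = p_x r_x in the latter case and z_x = 0 otherwise, and let
-- Z_I = 1 + Σ_{x ∈ U_I} z_x ≥ Σ_{x ∈ U_I} p_x r_x.  If the draws v all lie in U_I,
-- then log y ≤ y gives
--   Σ_i k(v_i) = log Π_i r(v_i) ≤ Π_i r(v_i) / (Z_I ^ n 2 ^ |I|) + n Z_I + |I|.
-- On average over v and I the first term is at most 1 (product formula for i.i.d.
-- draws, then Kraft's inequality), and for a filter the mean of Z_I is at most 3: the
-- elements of S contribute at most n · 1/n, those outside at most
-- Σ (q_x / ε) Pr[YES on x] ≤ 1.  For S ∉ T one uses instead k_x ≤ log u + r_x / u where
-- k_x ≠ 0; the event costs at most n log u / log u = n, and the correction at most
-- Σ n p_x r_x / u ≤ 1.  Restricting to finitely many instances that carry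
-- almost all of the mass costs another 1, and 3 + 4 n ≤ 1 + 6 n.
module Submission where

open import Defs
open import Data.Bool.Base using (Bool; true; false; if_then_else_)
import Data.Bool.Properties as Boolₚ
open import Data.Fin.Base using (Fin; zero; suc)
open import Data.Fin.Subset as Subset using (Subset)
import Data.Fin.Subset.Properties as Subsetₚ
open import Data.List.Base as List
  using (List; []; _∷_; _++_; length; allFin; tabulate; filter; deduplicate; cartesianProduct; cartesianProductWith)
import Data.List.Membership.DecPropositional as DecMembership
open import Data.List.Membership.Propositional using (_∈_; lose)
open import Data.List.Membership.Propositional.Properties
  using (∈-∃++; ∈-++⁻; ∈-++⁺ˡ; ∈-++⁺ʳ; ∈-deduplicate⁺; ∈-allFin; ∈-cartesianProductWith⁺; ∈-filter⁻)
import Data.List.Properties as Listₚ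
open import Data.List.Relation.Binary.Prefix.Heterogeneous using (Prefix; []; _∷_)
open import Data.List.Relation.Binary.Subset.Propositional using (_⊆_)
open import Data.List.Relation.Unary.All as All using (All; []; _∷_)
open import Data.List.Relation.Unary.All.Properties using (all-filter)
open import Data.List.Relation.Unary.AllPairs using (AllPairs; []; _∷_)
open import Data.List.Relation.Unary.Any using (here; there; any?; satisfied)
open import Data.List.Relation.Unary.Unique.DecPropositional.Properties using (deduplicate-!)
open import Data.List.Relation.Unary.Unique.Propositional using (Unique)
import Data.List.Relation.Unary.Unique.Propositional.Properties as Uniqueₚ
open import Data.Nat.Base as ℕ using (ℕ; zero; suc; z≤n; s≤s)
import Data.Nat.Properties as ℕₚ
open import Data.Nat.Solver using (module +-*-Solver)
open import Data.Product.Base using (∃; _×_; _,_; proj₁; proj₂)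
open import Data.Sum.Base using (inj₁; inj₂)
open import Data.Vec.Base as Vec using (Vec; []; _∷_; toList)
import Data.Vec.Properties as Vecₚ
open import Function.Base using (_∘_; id)
open import Level using (0ℓ)
open import Relation.Binary.Bundles using (TotalOrder)
open import Relation.Binary.Definitions using (DecidableEquality)
open import Relation.Binary.PropositionalEquality as ≡ using (_≡_; _≢_)
open import Relation.Nullary.Decidable
  using (Dec; yes; no; does; ¬?; _×-dec_; _⊎-dec_; dec-true; decidable-stable)
open import Relation.Nullary.Negation.Core using (¬_; contradiction)
open import Relation.Unary using (Pred; Decidable)

import Algebra.Construct.NaturalChoice.Min as Min
import Algebra.Construct.NaturalChoice.MinOp as MinOp
import Algebra.Properties.CommutativeSemiring.Exp as Exp
import Algebra.Properties.Monoid.Mult as MonoidMult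
import Algebra.Properties.Ring as RingProperties
import Algebra.Properties.Semiring.Mult as SemiringMult
import Algebra.Solver.Ring.NaturalCoefficients.Default as NaturalSolver
import Relation.Binary.Properties.DecTotalOrder as DecTotalOrderProperties
import Relation.Binary.Reasoning.PartialOrder as PartialOrderReasoning

-- Arithmetic in an ordered field; Archimedean property.

module OrderedField (ℝ : CompleteOrderedField) where
  open CompleteOrderedField ℝ public

  module ≤-Reasoning = PartialOrderReasoning (TotalOrder.poset totalOrder)
  open TotalOrder totalOrder public
    using (total; antisym; ≤-respʳ-≈; ≤-respˡ-≈)
    renaming (refl to ≤-refl; trans to ≤-trans; reflexive to ≤-reflexive)
  open DecTotalOrderProperties decTotalOrder public
    using (<⇒≱; ≰⇒>; ≮⇒≥; <-respʳ-≈)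
  open Exp commutativeSemiring public using (_^_; ^-congˡ; ^-distrib-*)
  open RingProperties ring using (-‿involutive; -1*x≈-x)
  module Solver = NaturalSolver commutativeSemiring

  open ≤-Reasoning

  -- Since the order is decidable, an inequality may be proved by contradiction. This is how
  -- witnesses that exist only up to double negation, such as those drawn from suprema, enter the
  -- proof.
  ≤-stable : ∀ {x y} → ¬ ¬ (x ≤ y) → x ≤ y
  ≤-stable {x} {y} = decidable-stable (x ≤? y)

  <⇒≤ : ∀ {x y} → x < y → x ≤ y
  <⇒≤ = proj₁

  ≤-<-trans : ∀ {x y z} → x ≤ y → y < z → x < z
  ≤-<-trans {x} {y} {z} x≤y y<z = begin-strict x ≤⟨ x≤y ⟩ y <⟨ y<z ⟩ z ∎

  <-≤-trans : ∀ {x y z} → x < y → y ≤ z → x < z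
  <-≤-trans {x} {y} {z} x<y y≤z = begin-strict x <⟨ x<y ⟩ y ≤⟨ y≤z ⟩ z ∎

  +-monoˡ-≤ : ∀ {x y} z → x ≤ y → x + z ≤ y + z
  +-monoˡ-≤ = +-mono-≤

  +-monoʳ-≤ : ∀ {x y} z → x ≤ y → z + x ≤ z + y
  +-monoʳ-≤ {x} {y} z x≤y = begin
    z + x ≈⟨ +-comm z x ⟩
    x + z ≤⟨ +-mono-≤ z x≤y ⟩
    y + z ≈⟨ +-comm y z ⟩
    z + y ∎

  +-mono₂-≤ : ∀ {w x y z} → w ≤ x → y ≤ z → w + y ≤ x + z
  +-mono₂-≤ w≤x y≤z = ≤-trans (+-monoˡ-≤ _ w≤x) (+-monoʳ-≤ _ y≤z)

  +-nonneg : ∀ {x y} → 0# ≤ x → 0# ≤ y → 0# ≤ x + y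
  +-nonneg 0≤x 0≤y = ≤-respˡ-≈ (+-identityˡ 0#) (+-mono₂-≤ 0≤x 0≤y)

  x≤x+y : ∀ {x y} → 0# ≤ y → x ≤ x + y
  x≤x+y {x} 0≤y = ≤-respˡ-≈ (+-identityʳ x) (+-monoʳ-≤ x 0≤y)

  x≤y+x : ∀ {x y} → 0# ≤ y → x ≤ y + x
  x≤y+x {x} 0≤y = ≤-respˡ-≈ (+-identityˡ x) (+-monoˡ-≤ x 0≤y)

  x≤y+z⇒x-z≤y : ∀ {x y z} → x ≤ y + z → x - z ≤ y
  x≤y+z⇒x-z≤y {x} {y} {z} x≤y+z = begin
    x - z         ≤⟨ +-monoˡ-≤ (- z) x≤y+z ⟩
    y + z - z     ≈⟨ +-assoc y z (- z) ⟩
    y + (z - z)   ≈⟨ +-congˡ (-‿inverseʳ z) ⟩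
    y + 0#        ≈⟨ +-identityʳ y ⟩
    y             ∎

  x+z≤y⇒x≤y-z : ∀ {x y z} → x + z ≤ y → x ≤ y - z
  x+z≤y⇒x≤y-z {x} {y} {z} x+z≤y = begin
    x             ≈⟨ +-identityʳ x ⟨
    x + 0#        ≈⟨ +-congˡ (-‿inverseʳ z) ⟨
    x + (z - z)   ≈⟨ +-assoc x z (- z) ⟨
    x + z - z     ≤⟨ +-monoˡ-≤ (- z) x+z≤y ⟩
    y - z         ∎

  +-cancelʳ-≤ : ∀ {x y} z → x + z ≤ y + z → x ≤ y
  +-cancelʳ-≤ {x} {y} z x+z≤y+z = begin
    x         ≤⟨ x+z≤y⇒x≤y-z x+z≤y+z ⟩
    y + z - z ≤⟨ x≤y+z⇒x-z≤y ≤-refl ⟩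
    y         ∎

  *-monoʳ-≤ : ∀ {x y z} → 0# ≤ z → x ≤ y → z * x ≤ z * y
  *-monoʳ-≤ {x} {y} {z} 0≤z x≤y = begin
    z * x                   ≤⟨ x≤y+x (*-nonneg 0≤z (x+z≤y⇒x≤y-z (≤-respˡ-≈ (sym (+-identityˡ x)) x≤y))) ⟩
    z * (y - x) + z * x     ≈⟨ distribˡ z (y - x) x ⟨
    z * ((y - x) + x)       ≈⟨ *-congˡ (+-assoc y (- x) x) ⟩
    z * (y + (- x + x))     ≈⟨ *-congˡ (+-congˡ (-‿inverseˡ x)) ⟩
    z * (y + 0#)            ≈⟨ *-congˡ (+-identityʳ y) ⟩
    z * y                   ∎

  *-monoˡ-≤ : ∀ {x y z} → 0# ≤ z → x ≤ y → x * z ≤ y * z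
  *-monoˡ-≤ {x} {y} {z} 0≤z x≤y = begin
    x * z ≈⟨ *-comm x z ⟩
    z * x ≤⟨ *-monoʳ-≤ 0≤z x≤y ⟩
    z * y ≈⟨ *-comm z y ⟩
    y * z ∎

  *-mono₂-≤ : ∀ {w x y z} → 0# ≤ w → 0# ≤ z → w ≤ x → y ≤ z → w * y ≤ x * z
  *-mono₂-≤ 0≤w 0≤z w≤x y≤z = ≤-trans (*-monoʳ-≤ 0≤w y≤z) (*-monoˡ-≤ 0≤z w≤x)

  0≤1 : 0# ≤ 1#
  0≤1 with total 0# 1#
  ... | inj₁ 0≤1 = 0≤1
  ... | inj₂ 1≤0 = begin
    0#            ≤⟨ *-nonneg 0≤-1 0≤-1 ⟩
    - 1# * - 1#   ≈⟨ -1*x≈-x (- 1#) ⟩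
    - (- 1#)      ≈⟨ -‿involutive 1# ⟩
    1#            ∎
    where
    0≤-1 : 0# ≤ - 1#
    0≤-1 = ≤-respʳ-≈ (+-identityˡ (- 1#)) (x+z≤y⇒x≤y-z (≤-respˡ-≈ (sym (+-identityˡ 1#)) 1≤0))

  0<1 : 0# < 1#
  0<1 = 0≤1 , 0≉1

  >⇒≉0 : ∀ {x} → 0# < x → ¬ (x ≈ 0#)
  >⇒≉0 (_ , 0≉x) x≈0 = 0≉x (sym x≈0)

  *-inverseʳ : ∀ {x} → 0# < x → x * x ⁻¹ ≈ 1#
  *-inverseʳ 0<x = *-inverse _ (>⇒≉0 0<x)

  /-cancelʳ : ∀ {x} y → 0# < x → y / x * x ≈ y
  /-cancelʳ {x} y 0<x = begin-equality
    y * x ⁻¹ * x   ≈⟨ *-assoc y (x ⁻¹) x ⟩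
    y * (x ⁻¹ * x) ≈⟨ *-congˡ (*-comm (x ⁻¹) x) ⟩
    y * (x * x ⁻¹) ≈⟨ *-congˡ (*-inverseʳ 0<x) ⟩
    y * 1#         ≈⟨ *-identityʳ y ⟩
    y              ∎

  ⁻¹-pos : ∀ {x} → 0# < x → 0# < x ⁻¹
  ⁻¹-pos {x} 0<x = ≰⇒> λ x⁻¹≤0 → <⇒≱ 0<1 (begin
    1#        ≈⟨ *-inverseʳ 0<x ⟨
    x * x ⁻¹  ≤⟨ *-monoʳ-≤ (<⇒≤ 0<x) x⁻¹≤0 ⟩
    x * 0#    ≈⟨ zeroʳ x ⟩
    0#        ∎)

  *-pos : ∀ {x y} → 0# < x → 0# < y → 0# < x * y
  *-pos {x} {y} 0<x 0<y = *-nonneg (<⇒≤ 0<x) (<⇒≤ 0<y) , λ 0≈x*y → proj₂ 0<x (begin-equality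
    0#              ≈⟨ zeroˡ (y ⁻¹) ⟨
    0# * y ⁻¹       ≈⟨ *-congʳ 0≈x*y ⟩
    x * y * y ⁻¹    ≈⟨ *-assoc x y (y ⁻¹) ⟩
    x * (y * y ⁻¹)  ≈⟨ *-congˡ (*-inverseʳ 0<y) ⟩
    x * 1#          ≈⟨ *-identityʳ x ⟩
    x               ∎)

  /-pos : ∀ {x y} → 0# < x → 0# < y → 0# < x / y
  /-pos 0<x 0<y = *-pos 0<x (⁻¹-pos 0<y)

  *-cancelʳ-≤ : ∀ {x y z} → 0# < z → x * z ≤ y * z → x ≤ y
  *-cancelʳ-≤ {x} {y} {z} 0<z x*z≤y*z = begin
    x             ≈⟨ cancel x ⟨
    x * z * z ⁻¹  ≤⟨ *-monoˡ-≤ (<⇒≤ (⁻¹-pos 0<z)) x*z≤y*z ⟩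
    y * z * z ⁻¹  ≈⟨ cancel y ⟩
    y             ∎
    where
    cancel : ∀ w → w * z * z ⁻¹ ≈ w
    cancel w = trans (*-assoc w z (z ⁻¹)) (trans (*-congˡ (*-inverseʳ 0<z)) (*-identityʳ w))

  x≤y/z⇒x*z≤y : ∀ {x y z} → 0# < z → x ≤ y / z → x * z ≤ y
  x≤y/z⇒x*z≤y {x} {y} {z} 0<z x≤y/z = begin
    x * z     ≤⟨ *-monoˡ-≤ (<⇒≤ 0<z) x≤y/z ⟩
    y / z * z ≈⟨ /-cancelʳ y 0<z ⟩
    y         ∎

  x*z≤y⇒x≤y/z : ∀ {x y z} → 0# < z → x * z ≤ y → x ≤ y / z
  x*z≤y⇒x≤y/z {x} {y} {z} 0<z x*z≤y = *-cancelʳ-≤ 0<z (begin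
    x * z     ≤⟨ x*z≤y ⟩
    y         ≈⟨ /-cancelʳ y 0<z ⟨
    y / z * z ∎)

  y≤x*z⇒y/z≤x : ∀ {x y z} → 0# < z → y ≤ x * z → y / z ≤ x
  y≤x*z⇒y/z≤x {x} {y} {z} 0<z y≤x*z = *-cancelʳ-≤ 0<z (begin
    y / z * z ≈⟨ /-cancelʳ y 0<z ⟩
    y         ≤⟨ y≤x*z ⟩
    x * z     ∎)

  ^-pos : ∀ {x} n → 0# < x → 0# < x ^ n
  ^-pos zero    0<x = 0<1
  ^-pos (suc n) 0<x = *-pos 0<x (^-pos n 0<x)

  ^-mono-≤ : ∀ {x y} n → 0# ≤ x → x ≤ y → x ^ n ≤ y ^ n
  ^-mono-≤ zero    0≤x x≤y = ≤-refl
  ^-mono-≤ {x} {y} (suc n) 0≤x x≤y = *-mono₂-≤ 0≤x (^-nonneg n) x≤y (^-mono-≤ n 0≤x x≤y)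
    where
    ^-nonneg : ∀ m → 0# ≤ y ^ m
    ^-nonneg zero    = 0≤1
    ^-nonneg (suc m) = *-nonneg (≤-trans 0≤x x≤y) (^-nonneg m)

  1^n≈1 : ∀ n → 1# ^ n ≈ 1#
  1^n≈1 zero    = refl
  1^n≈1 (suc n) = trans (*-identityˡ _) (1^n≈1 n)

  fromℕ-nonneg : ∀ n → 0# ≤ fromℕ n
  fromℕ-nonneg zero    = ≤-refl
  fromℕ-nonneg (suc n) = +-nonneg 0≤1 (fromℕ-nonneg n)

  fromℕ-mono-≤ : ∀ {m n} → m ℕ.≤ n → fromℕ m ≤ fromℕ n
  fromℕ-mono-≤ {n = n} z≤n = fromℕ-nonneg n
  fromℕ-mono-≤ (s≤s m≤n)   = +-monoʳ-≤ 1# (fromℕ-mono-≤ m≤n)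

  fromℕ-pos : ∀ {n} → 1 ℕ.≤ n → 0# < fromℕ n
  fromℕ-pos {suc n} _ = <-≤-trans 0<1 (x≤x+y (fromℕ-nonneg n))

  fromℕ-homo-* : ∀ m n → fromℕ (m ℕ.* n) ≈ fromℕ m * fromℕ n
  fromℕ-homo-* = SemiringMult.×1-homo-* semiring

  fromℕ-homo-+ : ∀ m n → fromℕ (m ℕ.+ n) ≈ fromℕ m + fromℕ n
  fromℕ-homo-+ = MonoidMult.×-homo-+ +-monoid 1#

  -- If the naturals were bounded, their supremum minus 1 would bound them too.
  archimedean : ∀ y → ¬ (∀ n → fromℕ n ≤ y)
  archimedean y ℕ≤y = <⇒≱ 0<1 (+-cancelʳ-≤ s (begin
    1# + s           ≤⟨ +-monoʳ-≤ 1# s≤s-1 ⟩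
    1# + (s - 1#)    ≈⟨ +-comm 1# (s - 1#) ⟩
    s - 1# + 1#      ≈⟨ trans (+-assoc s (- 1#) 1#) (+-congˡ (-‿inverseˡ 1#)) ⟩
    s + 0#           ≈⟨ +-comm s 0# ⟩
    0# + s           ∎))
    where
    IsNatural = λ t → ∃ λ n → t ≈ fromℕ n
    supremum = complete IsNatural (0# , 0 , refl) (y , λ { t (n , t≈n) → ≤-respˡ-≈ (sym t≈n) (ℕ≤y n) })
    s = proj₁ supremum
    s≤s-1 : s ≤ s - 1#
    s≤s-1 = proj₂ (proj₂ supremum) (s - 1#) λ { t (n , t≈n) → x+z≤y⇒x≤y-z (begin
      t + 1#          ≈⟨ +-congʳ t≈n ⟩
      fromℕ n + 1#    ≈⟨ +-comm (fromℕ n) 1# ⟩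
      fromℕ (suc n)   ≤⟨ proj₁ (proj₂ supremum) (fromℕ (suc n)) (suc n , refl) ⟩
      s               ∎) }

  2# : Carrier
  2# = 1# + 1#

  0<2 : 0# < 2#
  0<2 = <-≤-trans 0<1 (x≤x+y 0≤1)

  1+n≤2^n : ∀ n → fromℕ (suc n) ≤ 2# ^ n
  1+n≤2^n zero    = ≤-reflexive (+-identityʳ 1#)
  1+n≤2^n (suc n) = begin
    1# + fromℕ (suc n)        ≤⟨ +-mono₂-≤ (≤-trans (x≤x+y (fromℕ-nonneg n)) (1+n≤2^n n)) (1+n≤2^n n) ⟩
    2# ^ n + 2# ^ n           ≈⟨ +-cong (*-identityˡ (2# ^ n)) (*-identityˡ (2# ^ n)) ⟨
    1# * 2# ^ n + 1# * 2# ^ n ≈⟨ distribʳ (2# ^ n) 1# 1# ⟨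
    2# ^ suc n                ∎

-- The binary logarithm.

module LogarithmProperties {ℝ : CompleteOrderedField} (logarithm : BinaryLogarithm ℝ) where
  open OrderedField ℝ
  open BinaryLogarithm logarithm
  open ≤-Reasoning

  log-cong : ∀ {x y} → 0# < x → x ≈ y → log x ≈ log y
  log-cong 0<x x≈y = antisym (log-mono 0<x (≤-reflexive x≈y))
    (log-mono (<-respʳ-≈ x≈y 0<x) (≤-reflexive (sym x≈y)))

  log-1 : log 1# ≈ 0#
  log-1 = begin-equality
    log 1#                        ≈⟨ +-identityʳ _ ⟨
    log 1# + 0#                   ≈⟨ +-congˡ (-‿inverseʳ _) ⟨
    log 1# + (log 1# - log 1#)    ≈⟨ +-assoc _ _ _ ⟨
    log 1# + log 1# - log 1#      ≈⟨ +-congʳ (log-* 0<1 0<1) ⟨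
    log (1# * 1#) - log 1#        ≈⟨ +-congʳ (log-cong (*-pos 0<1 0<1) (*-identityˡ 1#)) ⟩
    log 1# - log 1#               ≈⟨ -‿inverseʳ _ ⟩
    0#                            ∎

  log-nonneg : ∀ {x} → 1# ≤ x → 0# ≤ log x
  log-nonneg 1≤x = ≤-respˡ-≈ log-1 (log-mono 0<1 1≤x)

  log-^ : ∀ {x} n → 0# < x → log (x ^ n) ≈ fromℕ n * log x
  log-^ zero    0<x = trans log-1 (sym (zeroˡ _))
  log-^ {x} (suc n) 0<x = begin-equality
    log (x * x ^ n)               ≈⟨ log-* 0<x (^-pos n 0<x) ⟩
    log x + log (x ^ n)           ≈⟨ +-cong (sym (*-identityˡ _)) (log-^ n 0<x) ⟩
    1# * log x + fromℕ n * log x  ≈⟨ distribʳ (log x) 1# (fromℕ n) ⟨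
    (1# + fromℕ n) * log x        ∎

  log-2^ : ∀ n → log (2# ^ n) ≈ fromℕ n
  log-2^ n = trans (log-^ n 0<2) (trans (*-congˡ log-2) (*-identityʳ _))

  -- With m = ⌊ y ⌋ we have log y ≤ log (1 + m) ≤ log (2 ^ m) = m.
  log-≤ : ∀ {y} → 0# < y → log y ≤ y
  log-≤ {y} 0<y = ≤-stable λ log≰ → archimedean y (bounded log≰)
    where
    bounded : ¬ (log y ≤ y) → ∀ n → fromℕ n ≤ y
    bounded log≰ zero    = <⇒≤ 0<y
    bounded log≰ (suc n) = ≮⇒≥ λ y<1+n → log≰ (begin
      log y               ≤⟨ log-mono 0<y (<⇒≤ y<1+n) ⟩
      log (fromℕ (suc n)) ≤⟨ log-mono (fromℕ-pos {suc n} (s≤s z≤n)) (1+n≤2^n n) ⟩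
      log (2# ^ n)        ≈⟨ log-2^ n ⟩
      fromℕ n             ≤⟨ bounded log≰ n ⟩
      y                   ∎)

  -- Makes `log u` positive for u ≥ 2, so that the bound 1 / log u on the rare event can be
  -- multiplied out.
  1≤log-fromℕ : ∀ {n} → 2 ℕ.≤ n → 1# ≤ log (fromℕ n)
  1≤log-fromℕ {n} 2≤n = begin
    1#              ≈⟨ log-2 ⟨
    log 2#          ≤⟨ log-mono 0<2 (begin
      1# + 1#         ≈⟨ +-congˡ (+-identityʳ 1#) ⟨
      fromℕ 2         ≤⟨ fromℕ-mono-≤ 2≤n ⟩
      fromℕ n         ∎) ⟩
    log (fromℕ n)   ∎

-- Finite sums over lists.

module FiniteSums {ℝ : CompleteOrderedField} (logarithm : BinaryLogarithm ℝ) where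
  open OrderedField ℝ
  open Filters ℝ logarithm
  open ≤-Reasoning

  when-nonneg : ∀ {x} b → 0# ≤ x → 0# ≤ (x when b)
  when-nonneg true  0≤x = 0≤x
  when-nonneg false 0≤x = ≤-refl

  when-≤ : ∀ {x} b → 0# ≤ x → (x when b) ≤ x
  when-≤ true  0≤x = ≤-refl
  when-≤ false 0≤x = 0≤x

  when-mono : ∀ {x y} b → x ≤ y → (x when b) ≤ (y when b)
  when-mono true  x≤y = x≤y
  when-mono false x≤y = ≤-refl

  *-when : ∀ x y b → x * (y when b) ≈ (x * y when b)
  *-when x y true  = refl
  *-when x y false = zeroʳ x

  module _ {X : Set} where

    sumOver-mono : {f g : X → Carrier} → (∀ x → f x ≤ g x) → ∀ xs → sumOver f xs ≤ sumOver g xs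
    sumOver-mono f≤g []       = ≤-refl
    sumOver-mono f≤g (x ∷ xs) = +-mono₂-≤ (f≤g x) (sumOver-mono f≤g xs)

    sumOver-cong : {f g : X → Carrier} → (∀ x → f x ≈ g x) → ∀ xs → sumOver f xs ≈ sumOver g xs
    sumOver-cong f≈g []       = refl
    sumOver-cong f≈g (x ∷ xs) = +-cong (f≈g x) (sumOver-cong f≈g xs)

    sumOver-nonneg : {f : X → Carrier} → (∀ x → 0# ≤ f x) → ∀ xs → 0# ≤ sumOver f xs
    sumOver-nonneg 0≤f []       = ≤-refl
    sumOver-nonneg 0≤f (x ∷ xs) = +-nonneg (0≤f x) (sumOver-nonneg 0≤f xs)

    sumOver-+ : ∀ (f g : X → Carrier) xs → sumOver (λ x → f x + g x) xs ≈ sumOver f xs + sumOver g xs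
    sumOver-+ f g []       = sym (+-identityʳ 0#)
    sumOver-+ f g (x ∷ xs) = begin-equality
      f x + g x + sumOver (λ y → f y + g y) xs  ≈⟨ +-congˡ (sumOver-+ f g xs) ⟩
      f x + g x + (sumOver f xs + sumOver g xs) ≈⟨ solve 4 (λ a b c d → (a :+ b) :+ (c :+ d) := (a :+ c) :+ (b :+ d)) refl _ _ _ _ ⟩
      f x + sumOver f xs + (g x + sumOver g xs) ∎
      where open Solver

    sumOver-*ˡ : ∀ c (f : X → Carrier) xs → sumOver (λ x → c * f x) xs ≈ c * sumOver f xs
    sumOver-*ˡ c f []       = sym (zeroʳ c)
    sumOver-*ˡ c f (x ∷ xs) = trans (+-congˡ (sumOver-*ˡ c f xs)) (sym (distribˡ c _ _))

    sumOver-*ʳ : ∀ c (f : X → Carrier) xs → sumOver (λ x → f x * c) xs ≈ sumOver f xs * c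
    sumOver-*ʳ c f []       = sym (zeroˡ c)
    sumOver-*ʳ c f (x ∷ xs) = trans (+-congˡ (sumOver-*ʳ c f xs)) (sym (distribʳ c _ _))

    sumOver-bounded : {f : X → Carrier} {c : Carrier} → (∀ x → f x ≤ c) →
      ∀ xs → sumOver f xs ≤ fromℕ (length xs) * c
    sumOver-bounded f≤c []       = ≤-reflexive (sym (zeroˡ _))
    sumOver-bounded {f = f} {c} f≤c (x ∷ xs) = begin
      f x + sumOver f xs              ≤⟨ +-mono₂-≤ (f≤c x) (sumOver-bounded f≤c xs) ⟩
      c + fromℕ (length xs) * c       ≈⟨ +-congʳ (*-identityˡ c) ⟨
      1# * c + fromℕ (length xs) * c  ≈⟨ distribʳ c 1# _ ⟨
      (1# + fromℕ (length xs)) * c    ∎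

    sumOver-0 : ∀ (xs : List X) → sumOver (λ _ → 0#) xs ≈ 0#
    sumOver-0 []       = refl
    sumOver-0 (x ∷ xs) = trans (+-identityˡ _) (sumOver-0 xs)

    sumOver-++ : ∀ (f : X → Carrier) xs ys → sumOver f (xs ++ ys) ≈ sumOver f xs + sumOver f ys
    sumOver-++ f []       ys = sym (+-identityˡ _)
    sumOver-++ f (x ∷ xs) ys = trans (+-congˡ (sumOver-++ f xs ys)) (sym (+-assoc _ _ _))

    sumOver-filter : ∀ {P : Pred X 0ℓ} (P? : Decidable P) (f : X → Carrier) xs →
      sumOver (λ x → f x when does (P? x)) xs ≈ sumOver f (filter P? xs)
    sumOver-filter P? f []       = refl
    sumOver-filter P? f (x ∷ xs) with does (P? x)
    ... | true  = +-congˡ (sumOver-filter P? f xs)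
    ... | false = trans (+-identityˡ _) (sumOver-filter P? f xs)

    -- Each entry of `xs` uses up one occurrence in `ys`. The rest of `xs` still lies in what
    -- remains, because `xs` has no repetitions; `ys` may have some, and its leftover terms are
    -- nonnegative.
    sumOver-⊆ : {f : X → Carrier} → (∀ x → 0# ≤ f x) →
      ∀ {xs ys} → Unique xs → xs ⊆ ys → sumOver f xs ≤ sumOver f ys
    sumOver-⊆ 0≤f {[]}     {ys} _ _ = sumOver-nonneg 0≤f ys
    sumOver-⊆ {f} 0≤f {x ∷ xs} {ys} x∷xs!@(_ ∷ xs!) x∷xs⊆ys with ∈-∃++ (x∷xs⊆ys (here ≡.refl))
    ... | as , bs , ≡.refl = begin
      f x + sumOver f xs                        ≤⟨ +-monoʳ-≤ (f x) (sumOver-⊆ 0≤f xs! xs⊆as++bs) ⟩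
      f x + sumOver f (as ++ bs)                ≈⟨ +-congˡ (sumOver-++ f as bs) ⟩
      f x + (sumOver f as + sumOver f bs)       ≈⟨ solve 3 (λ a b c → a :+ (b :+ c) := b :+ (a :+ c)) refl _ _ _ ⟩
      sumOver f as + (f x + sumOver f bs)       ≈⟨ sumOver-++ f as (x ∷ bs) ⟨
      sumOver f (as ++ x ∷ bs)                  ∎
      where
      open Solver
      xs⊆as++bs : xs ⊆ as ++ bs
      xs⊆as++bs y∈xs with ∈-++⁻ as (x∷xs⊆ys (there y∈xs))
      ... | inj₁ y∈as            = ∈-++⁺ˡ y∈as
      ... | inj₂ (here ≡.refl)   = contradiction y∈xs (Uniqueₚ.Unique[x∷xs]⇒x∉xs x∷xs!)
      ... | inj₂ (there y∈bs)    = ∈-++⁺ʳ as y∈bs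

  module _ {X Y : Set} where

    sumOver-map : ∀ (f : Y → Carrier) (g : X → Y) xs → sumOver f (List.map g xs) ≈ sumOver (f ∘ g) xs
    sumOver-map f g []       = refl
    sumOver-map f g (x ∷ xs) = +-congˡ (sumOver-map f g xs)

    sumOver-swap : ∀ (f : X → Y → Carrier) xs ys →
      sumOver (λ x → sumOver (f x) ys) xs ≈ sumOver (λ y → sumOver (λ x → f x y) xs) ys
    sumOver-swap f []       ys = sym (sumOver-0 ys)
    sumOver-swap f (x ∷ xs) ys = trans (+-congˡ (sumOver-swap f xs ys)) (sym (sumOver-+ (f x) _ ys))

  sumOver-cartesianProductWith : ∀ {X Y Z : Set} (f : Z → Carrier) (g : X → Y → Z) xs ys →
    sumOver f (cartesianProductWith g xs ys) ≈ sumOver (λ x → sumOver (λ y → f (g x y)) ys) xs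
  sumOver-cartesianProductWith f g []       ys = refl
  sumOver-cartesianProductWith f g (x ∷ xs) ys = begin-equality
    sumOver f (List.map (g x) ys ++ cartesianProductWith g xs ys)
      ≈⟨ sumOver-++ f (List.map (g x) ys) _ ⟩
    sumOver f (List.map (g x) ys) + sumOver f (cartesianProductWith g xs ys)
      ≈⟨ +-cong (sumOver-map f (g x) ys) (sumOver-cartesianProductWith f g xs ys) ⟩
    sumOver (λ y → f (g x y)) ys + sumOver (λ x → sumOver (λ y → f (g x y)) ys) xs ∎

  sumOver-tabulate : ∀ {X : Set} {u} (f : X → Carrier) (g : Fin u → X) →
    sumOver f (tabulate g) ≈ sum (f ∘ g)
  sumOver-tabulate {u = zero}  f g = refl
  sumOver-tabulate {u = suc u} f g = +-congˡ (sumOver-tabulate f (g ∘ suc))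

  sumOver-allFin : ∀ {u} (f : Fin u → Carrier) → sumOver f (allFin u) ≈ sum f
  sumOver-allFin f = sumOver-tabulate f id

  -- Powers of one half and Kraft's inequality.

  ½ : Carrier
  ½ = 2# ⁻¹

  0<½ : 0# < ½
  0<½ = ⁻¹-pos 0<2

  2^n*½^n≈1 : ∀ n → 2# ^ n * ½ ^ n ≈ 1#
  2^n*½^n≈1 n = begin-equality
    2# ^ n * ½ ^ n ≈⟨ ^-distrib-* 2# ½ n ⟨
    (2# * ½) ^ n   ≈⟨ ^-congˡ n (*-inverseʳ 0<2) ⟩
    1# ^ n         ≈⟨ 1^n≈1 n ⟩
    1#             ∎

  ½x+½x≈x : ∀ x → ½ * x + ½ * x ≈ x
  ½x+½x≈x x = begin-equality
    ½ * x + ½ * x               ≈⟨ +-cong (*-identityˡ (½ * x)) (*-identityˡ (½ * x)) ⟨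
    1# * (½ * x) + 1# * (½ * x) ≈⟨ distribʳ (½ * x) 1# 1# ⟨
    2# * (½ * x)                ≈⟨ *-assoc 2# ½ x ⟨
    2# * ½ * x                  ≈⟨ *-congʳ (*-inverseʳ 0<2) ⟩
    1# * x                      ≈⟨ *-identityˡ x ⟩
    x                           ∎

  -- Both directions are excluded because `AllPairs` tests each pair only in the order of the list.
  Incomparable : List Bool → List Bool → Set
  Incomparable I J = ¬ Prefix _≡_ I J × ¬ Prefix _≡_ J I

  -- The left quotient (Brzozowski derivative) of a list of strings by a letter, that is, the
  -- subtree of the code tree below `b`. The empty string has no first letter and is dropped.
  tails : Bool → List (List Bool) → List (List Bool)
  tails b []            = []
  tails b ([] ∷ L)      = tails b L
  tails b ((c ∷ I) ∷ L) = if does (b Boolₚ.≟ c) then I ∷ tails b L else tails b L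

  tails-length : ∀ b {m L} → All (λ I → length I ℕ.≤ suc m) L → All (λ I → length I ℕ.≤ m) (tails b L)
  tails-length b []                             = []
  tails-length b {L = [] ∷ L}      (_ ∷ ≤m)     = tails-length b ≤m
  tails-length b {L = (c ∷ I) ∷ L} (s≤s I≤ ∷ ≤m) with does (b Boolₚ.≟ c)
  ... | true  = I≤ ∷ tails-length b ≤m
  ... | false = tails-length b ≤m

  -- A prefix relation between two tails extends to the strings themselves by prepending the common
  -- letter `b`.
  tails-incomparable₁ : ∀ b {I L} → All (Incomparable (b ∷ I)) L → All (Incomparable I) (tails b L)
  tails-incomparable₁ b []                                    = []
  tails-incomparable₁ b {L = [] ∷ L}      (_ ∷ inc)           = tails-incomparable₁ b inc
  tails-incomparable₁ b {L = (c ∷ J) ∷ L} ((I⋠J , J⋠I) ∷ inc) with b Boolₚ.≟ c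
  ... | yes ≡.refl = (I⋠J ∘ (≡.refl ∷_) , J⋠I ∘ (≡.refl ∷_)) ∷ tails-incomparable₁ b inc
  ... | no  _      = tails-incomparable₁ b inc

  tails-incomparable : ∀ b {L} → AllPairs Incomparable L → AllPairs Incomparable (tails b L)
  tails-incomparable b []                                  = []
  tails-incomparable b {[] ∷ L}      (_ ∷ incs)            = tails-incomparable b incs
  tails-incomparable b {(c ∷ I) ∷ L} (inc ∷ incs) with b Boolₚ.≟ c
  ... | yes ≡.refl = tails-incomparable₁ b inc ∷ tails-incomparable b incs
  ... | no  _      = tails-incomparable b incs

  kraftSum : List (List Bool) → Carrier
  kraftSum = sumOver (λ I → ½ ^ length I)

  -- A nonempty string goes into exactly one of the two quotients, where it is one bit shorter and
  -- hence has twice the weight.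
  kraftSum-tails : ∀ {L} → All (_≢ []) L →
    kraftSum L ≈ ½ * kraftSum (tails true L) + ½ * kraftSum (tails false L)
  kraftSum-tails []               = sym (trans (+-cong (zeroʳ ½) (zeroʳ ½)) (+-identityʳ 0#))
  kraftSum-tails {[] ∷ L}          (≢[] ∷ _)   = contradiction ≡.refl ≢[]
  kraftSum-tails {(true ∷ I) ∷ L}  (_ ∷ ≢[]) = trans (+-congˡ (kraftSum-tails ≢[]))
    (solve 4 (λ h i a b → h :* i :+ (h :* a :+ h :* b) := h :* (i :+ a) :+ h :* b) refl _ _ _ _)
    where open Solver
  kraftSum-tails {(false ∷ I) ∷ L} (_ ∷ ≢[]) = trans (+-congˡ (kraftSum-tails ≢[]))
    (solve 4 (λ h i a b → h :* i :+ (h :* a :+ h :* b) := h :* a :+ h :* (i :+ b)) refl _ _ _ _)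
    where open Solver

  -- Induction on a bound for the lengths: splitting by the first bit leaves two codes with shorter
  -- words, and each enters with the factor one half.
  kraft-bounded : ∀ m {L} → All (λ I → length I ℕ.≤ m) L → AllPairs Incomparable L → kraftSum L ≤ 1#
  kraft-bounded m       {[]}           _ _ = 0≤1
  -- The empty string is a prefix of every string, so a code that contains it has no other word.
  -- After a nonempty head it is ruled out by `nonEmpty`.
  kraft-bounded m       {[] ∷ []}      _ _ = ≤-reflexive (+-identityʳ 1#)
  kraft-bounded m       {[] ∷ J ∷ L}   _ (((⋠ , _) ∷ _) ∷ _) = contradiction [] ⋠
  kraft-bounded zero    {(b ∷ I) ∷ L}  (() ∷ _) _
  kraft-bounded (suc m) {L@((b ∷ I) ∷ _)} ≤m incs@(inc ∷ _) = begin
    kraftSum L                                             ≈⟨ kraftSum-tails {L} ((λ ()) ∷ All.map nonEmpty inc) ⟩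
    ½ * kraftSum (tails true L) + ½ * kraftSum (tails false L) ≤⟨ +-mono₂-≤ (half true) (half false) ⟩
    ½ * 1# + ½ * 1#                                        ≈⟨ ½x+½x≈x 1# ⟩
    1#                                                     ∎
    where
    nonEmpty : ∀ {J} → Incomparable (b ∷ I) J → J ≢ []
    nonEmpty (_ , []⋠) ≡.refl = []⋠ []
    half : ∀ c → ½ * kraftSum (tails c L) ≤ ½ * 1#
    half c = *-monoʳ-≤ (<⇒≤ 0<½) (kraft-bounded m (tails-length c ≤m) (tails-incomparable c incs))

  kraft : ∀ {L} → AllPairs Incomparable L → kraftSum L ≤ 1#
  kraft {L} = kraft-bounded (lengthBound L) (bounded L)
    where
    lengthBound : List (List Bool) → ℕ
    lengthBound []      = 0
    lengthBound (I ∷ L) = length I ℕ.⊔ lengthBound L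
    bounded : ∀ L → All (λ I → length I ℕ.≤ lengthBound L) L
    bounded []      = []
    bounded (I ∷ L) = ℕₚ.m≤m⊔n _ _ ∷ All.map (λ I≤ → ℕₚ.≤-trans I≤ (ℕₚ.m≤n⊔m (length I) _)) (bounded L)

  -- Distributions on strings.

  _≟ˢ_ : DecidableEquality (List Bool)
  _≟ˢ_ = Listₚ.≡-dec Boolₚ._≟_

  open DecMembership _≟ˢ_ using (_∈?_)

  module _ (D : StringDistribution) where
    open StringDistribution D renaming (total to mass-total)

    partial-≤1 : ∀ {L} → Unique L → sumOver mass L ≤ 1#
    partial-≤1 {L} L! = proj₁ mass-total _ (L , L! , refl)

    mass-≤1 : ∀ I → mass I ≤ 1#
    mass-≤1 I = ≤-respˡ-≈ (+-identityʳ (mass I)) (partial-≤1 {I ∷ []} ([] ∷ []))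

    -- If `I` occurs in `L`, its term on the left is 0, which leaves room for `mass I` within the
    -- mass of `L`. Otherwise `I ∷ L` is again free of repetitions and has mass at most 1.
    excluded-mass : ∀ (E : List Bool → Bool) {I} → E I ≡ false → ∀ {L} → Unique L →
      sumOver (λ J → mass J when E J) L + mass I ≤ 1#
    excluded-mass E {I} ¬EI {L} L! with I ∈? L
    ... | yes I∈L = ≤-trans (go I∈L) (partial-≤1 L!)
      where
      open Solver
      when≤ : ∀ J → (mass J when E J) ≤ mass J
      when≤ J = when-≤ (E J) (nonneg J)
      go : ∀ {L} → I ∈ L → sumOver (λ J → mass J when E J) L + mass I ≤ sumOver mass L
      go {J ∷ L} (here ≡.refl) rewrite ¬EI = begin
        0# + sumOver (λ J → mass J when E J) L + mass I ≈⟨ +-congʳ (+-identityˡ _) ⟩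
        sumOver (λ J → mass J when E J) L + mass I      ≤⟨ +-monoˡ-≤ _ (sumOver-mono when≤ L) ⟩
        sumOver mass L + mass I                         ≈⟨ +-comm _ _ ⟩
        mass I + sumOver mass L                         ∎
      go {J ∷ L} (there I∈L) = begin
        (mass J when E J) + sumOver (λ J → mass J when E J) L + mass I   ≈⟨ +-assoc _ _ _ ⟩
        (mass J when E J) + (sumOver (λ J → mass J when E J) L + mass I) ≤⟨ +-mono₂-≤ (when≤ J) (go I∈L) ⟩
        mass J + sumOver mass L ∎
    ... | no  I∉L = begin
      sumOver (λ J → mass J when E J) L + mass I
        ≤⟨ +-monoˡ-≤ _ (sumOver-mono (λ J → when-≤ (E J) (nonneg J)) L) ⟩
      sumOver mass L + mass I   ≈⟨ +-comm _ _ ⟩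
      mass I + sumOver mass L   ≤⟨ partial-≤1 (All.tabulate (λ { J∈L ≡.refl → I∉L J∈L }) ∷ L!) ⟩
      1#                        ∎

    -- If `E` failed at `I`, then by `excluded-mass` the number 1 - `mass I` would bound all partial
    -- sums, and their supremum could not be 1.
    certain : ∀ E → IsProbability D E 1# → ∀ {I} → 0# < mass I → E I ≡ true
    certain E (_ , least) {I} 0<mass with E I in EI
    ... | true  = ≡.refl
    ... | false = contradiction (least (1# - mass I) bound) λ 1≤1-mass →
      <⇒≱ 0<mass (+-cancelʳ-≤ 1# (begin
        mass I + 1#           ≈⟨ +-comm _ _ ⟩
        1# + mass I           ≤⟨ +-monoˡ-≤ (mass I) 1≤1-mass ⟩
        1# - mass I + mass I  ≈⟨ trans (+-assoc _ _ _) (+-congˡ (-‿inverseˡ _)) ⟩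
        1# + 0#               ≈⟨ +-comm _ _ ⟩
        0# + 1#               ∎))
      where
      bound : (1# - mass I) isUpperBoundOf _
      bound t (L , L! , t≈) = x+z≤y⇒x≤y-z (≤-respˡ-≈ (+-congʳ (sym t≈)) (excluded-mass E EI L!))

    -- If every list fell short by more than δ, then 1 - δ would bound all partial sums, below their
    -- supremum 1. A supremum yields no list explicitly, whence the double negation.
    almostAll : ∀ {δ} → 0# < δ → ¬ ¬ (∃ λ L → Unique L × 1# ≤ sumOver mass L + δ)
    almostAll {δ} 0<δ none = <⇒≱ 0<δ (+-cancelʳ-≤ 1# (begin
      δ + 1#        ≤⟨ +-monoʳ-≤ δ (proj₂ mass-total (1# - δ) bound) ⟩
      δ + (1# - δ)  ≈⟨ trans (+-comm _ _) (trans (+-assoc _ _ _) (+-congˡ (-‿inverseˡ δ))) ⟩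
      1# + 0#       ≈⟨ +-comm _ _ ⟩
      0# + 1#       ∎))
      where
      bound : (1# - δ) isUpperBoundOf _
      bound t (L , L! , t≈) = x+z≤y⇒x≤y-z (≮⇒≥ λ 1<t+δ →
        none (L , L! , ≤-trans (<⇒≤ 1<t+δ) (≤-reflexive (+-congʳ t≈))))

  -- One list must serve all draw sequences, so that sums over draws and over instances can be
  -- exchanged. Merging lists only increases the mass they carry, and deduplication keeps every
  -- entry.
  almostAll-common : ∀ {X : Set} (D : X → StringDistribution) {δ} → 0# < δ → ∀ xs →
    ¬ ¬ (∃ λ L → Unique L × All (λ x → 1# ≤ sumOver (StringDistribution.mass (D x)) L + δ) xs)
  almostAll-common D 0<δ []       none = none ([] , [] , [])
  almostAll-common D {δ} 0<δ (x ∷ xs) none =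
    almostAll (D x) 0<δ λ { (L , L! , big) →
    almostAll-common D 0<δ xs λ { (M , M! , bigs) →
      let N = deduplicate _≟ˢ_ (L ++ M)
          grow : ∀ y {K} → Unique K → K ⊆ L ++ M →
            1# ≤ sumOver (StringDistribution.mass (D y)) K + δ →
            1# ≤ sumOver (StringDistribution.mass (D y)) N + δ
          grow y K! K⊆ K-big = ≤-trans K-big (+-monoˡ-≤ δ
            (sumOver-⊆ (StringDistribution.nonneg (D y)) K! (∈-deduplicate⁺ _≟ˢ_ ∘ K⊆)))
      in none (N , deduplicate-! _≟ˢ_ (L ++ M) , grow x L! ∈-++⁺ˡ big ∷
           All.map (λ {y} → grow y M! (∈-++⁺ʳ L)) bigs) } }

-- Sequences of independent draws and their expectations.

module Draws {ℝ : CompleteOrderedField} (logarithm : BinaryLogarithm ℝ) where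
  open OrderedField ℝ
  open LogarithmProperties logarithm
  open Filters ℝ logarithm
  open BinaryLogarithm logarithm using (log-*)
  open FiniteSums logarithm
  open ≤-Reasoning

  module _ {X : Set} where

    -- Written in the same form as `weight`, so that `weight 𝒫` is by definition the product of the
    -- masses of `𝒫`.
    prodᵛ : (X → Carrier) → ∀ {n} → Vec X n → Carrier
    prodᵛ f v = Vec.foldr _ _*_ 1# (Vec.map f v)

    sumᵛ : (X → Carrier) → ∀ {n} → Vec X n → Carrier
    sumᵛ f v = sumOver f (toList v)

    prodᵛ-pos : ∀ {f} → (∀ x → 0# < f x) → ∀ {n} (v : Vec X n) → 0# < prodᵛ f v
    prodᵛ-pos 0<f []      = 0<1
    prodᵛ-pos 0<f (x ∷ v) = *-pos (0<f x) (prodᵛ-pos 0<f v)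

    prodᵛ-nonneg : ∀ {f} → (∀ x → 0# ≤ f x) → ∀ {n} (v : Vec X n) → 0# ≤ prodᵛ f v
    prodᵛ-nonneg 0≤f []      = 0≤1
    prodᵛ-nonneg 0≤f (x ∷ v) = *-nonneg (0≤f x) (prodᵛ-nonneg 0≤f v)

    prodᵛ-* : ∀ f g {n} (v : Vec X n) → prodᵛ (λ x → f x * g x) v ≈ prodᵛ f v * prodᵛ g v
    prodᵛ-* f g []      = sym (*-identityˡ 1#)
    prodᵛ-* f g (x ∷ v) = trans (*-congˡ (prodᵛ-* f g v))
      (solve 4 (λ a b c d → (a :* b) :* (c :* d) := (a :* c) :* (b :* d)) refl _ _ _ _)
      where open Solver

    prodᵛ-when : ∀ f (b : X → Bool) {n} (v : Vec X n) → (∀ {x} → x ∈ toList v → b x ≡ true) →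
      prodᵛ (λ x → f x when b x) v ≈ prodᵛ f v
    prodᵛ-when f b []      _  = refl
    prodᵛ-when f b (x ∷ v) bv rewrite bv (here ≡.refl) = *-congˡ (prodᵛ-when f b v (bv ∘ there))

    log-prodᵛ : ∀ {f} → (∀ x → 0# < f x) → ∀ {n} (v : Vec X n) → log (prodᵛ f v) ≈ sumᵛ (log ∘ f) v
    log-prodᵛ 0<f []      = log-1
    log-prodᵛ 0<f (x ∷ v) = trans (log-* (0<f x) (prodᵛ-pos 0<f v)) (+-congˡ (log-prodᵛ 0<f v))

  module _ {u : ℕ} where

    distinct⁺ : ∀ {n x} (v : Vec (Fin u) n) → x ∈ toList v → x Subset.∈ distinct v
    distinct⁺ (y ∷ v) (here ≡.refl) = Subsetₚ.x∈p∪q⁺ (inj₁ (Subsetₚ.x∈⁅x⁆ y))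
    distinct⁺ (y ∷ v) (there x∈v)   = Subsetₚ.x∈p∪q⁺ (inj₂ (distinct⁺ v x∈v))

    distinct⁻ : ∀ {n x} (v : Vec (Fin u) n) → x Subset.∈ distinct v → x ∈ toList v
    distinct⁻ []      x∈⊥ = contradiction x∈⊥ Subsetₚ.∉⊥
    distinct⁻ (y ∷ v) x∈  with Subsetₚ.x∈p∪q⁻ Subset.⁅ y ⁆ (distinct v) x∈
    ... | inj₁ x∈⁅y⁆ = here (Subsetₚ.x∈⁅y⁆⇒x≡y y x∈⁅y⁆)
    ... | inj₂ x∈v   = there (distinct⁻ v x∈v)

    -- The set counts an element once, while the sequence may draw it repeatedly; the surplus terms
    -- are nonnegative.
    sum-distinct : ∀ {f : Fin u → Carrier} → (∀ x → 0# ≤ f x) → ∀ {n} (v : Vec (Fin u) n) →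
      sumOver (λ x → f x when does (x Subsetₚ.∈? distinct v)) (allFin u) ≤ sumᵛ f v
    sum-distinct {f} 0≤f v = begin
      sumOver (λ x → f x when does (x Subsetₚ.∈? distinct v)) (allFin u)
        ≈⟨ sumOver-filter (Subsetₚ._∈? distinct v) f (allFin u) ⟩
      sumOver f (filter (Subsetₚ._∈? distinct v) (allFin u))
        ≤⟨ sumOver-⊆ 0≤f (Uniqueₚ.filter⁺ (Subsetₚ._∈? distinct v) (Uniqueₚ.allFin⁺ u))
             (distinct⁻ v ∘ proj₂ ∘ ∈-filter⁻ (Subsetₚ._∈? distinct v) {xs = allFin u}) ⟩
      sumᵛ f v ∎

    ∈-drawSequences : ∀ {n} (v : Vec (Fin u) n) → v ∈ drawSequences n
    ∈-drawSequences []      = here ≡.refl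
    ∈-drawSequences (x ∷ v) = ∈-cartesianProductWith⁺ _∷_ (∈-allFin x) (∈-drawSequences v)

    drawSequences-unique : ∀ n → Unique (drawSequences {u} n)
    drawSequences-unique zero    = [] ∷ []
    drawSequences-unique (suc n) =
      Uniqueₚ.cartesianProductWith⁺ _∷_ Vecₚ.∷-injective (Uniqueₚ.allFin⁺ u) (drawSequences-unique n)

    -- Independence of the draws: by distributivity, the n-fold product of a sum expands into one
    -- product per sequence.
    sumOver-prodᵛ : ∀ f n → sumOver (prodᵛ f) (drawSequences n) ≈ sumOver f (allFin u) ^ n
    sumOver-prodᵛ f zero    = +-identityʳ 1#
    sumOver-prodᵛ f (suc n) = begin-equality
      sumOver (prodᵛ f) (drawSequences (suc n))
        ≈⟨ sumOver-cartesianProductWith (prodᵛ f) _∷_ (allFin u) (drawSequences n) ⟩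
      sumOver (λ x → sumOver (λ v → f x * prodᵛ f v) (drawSequences n)) (allFin u)
        ≈⟨ sumOver-cong (λ x → sumOver-*ˡ (f x) (prodᵛ f) (drawSequences n)) (allFin u) ⟩
      sumOver (λ x → f x * sumOver (prodᵛ f) (drawSequences n)) (allFin u)
        ≈⟨ sumOver-*ʳ _ f (allFin u) ⟩
      sumOver f (allFin u) * sumOver (prodᵛ f) (drawSequences n)
        ≈⟨ *-congˡ (sumOver-prodᵛ f n) ⟩
      sumOver f (allFin u) ^ suc n ∎

    module Expectation (𝒫 : Distribution u) where
      open Distribution 𝒫 renaming (mass to p; nonneg to 0≤p; total to p-mass)

      Σp≈1 : sumOver p (allFin u) ≈ 1#
      Σp≈1 = trans (sumOver-allFin p) p-mass

      weight-nonneg : ∀ {n} (v : Vec (Fin u) n) → 0# ≤ weight 𝒫 v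
      weight-nonneg = prodᵛ-nonneg 0≤p

      Σweight≈1 : ∀ n → sumOver (weight 𝒫) (drawSequences n) ≈ 1#
      Σweight≈1 n = begin-equality
        sumOver (weight 𝒫) (drawSequences n)  ≈⟨ sumOver-prodᵛ p n ⟩
        sumOver p (allFin u) ^ n              ≈⟨ ^-congˡ n Σp≈1 ⟩
        1# ^ n                                ≈⟨ 1^n≈1 n ⟩
        1#                                    ∎

      𝔼 : ∀ {n} → (Vec (Fin u) n → Carrier) → Carrier
      𝔼 {n} f = sumOver (λ v → weight 𝒫 v * f v) (drawSequences n)

      𝔼-mono : ∀ {n} {f g : Vec (Fin u) n → Carrier} → (∀ v → f v ≤ g v) → 𝔼 f ≤ 𝔼 g
      𝔼-mono {n} f≤g = sumOver-mono (λ v → *-monoʳ-≤ (weight-nonneg v) (f≤g v)) (drawSequences n)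

      𝔼-+ : ∀ {n} (f g : Vec (Fin u) n → Carrier) → 𝔼 (λ v → f v + g v) ≈ 𝔼 f + 𝔼 g
      𝔼-+ {n} f g = trans (sumOver-cong (λ v → distribˡ _ (f v) (g v)) (drawSequences n))
        (sumOver-+ _ _ (drawSequences n))

      𝔼-*ˡ : ∀ {n} c (f : Vec (Fin u) n → Carrier) → 𝔼 (λ v → c * f v) ≈ c * 𝔼 f
      𝔼-*ˡ {n} c f = trans
        (sumOver-cong (λ v → solve 3 (λ w c f → w :* (c :* f) := c :* (w :* f)) refl _ c (f v)) (drawSequences n))
        (sumOver-*ˡ c _ (drawSequences n))
        where open Solver

      𝔼-const : ∀ {n} c → 𝔼 {n} (λ _ → c) ≈ c
      𝔼-const {n} c = begin-equality
        sumOver (λ v → weight 𝒫 v * c) (drawSequences n) ≈⟨ sumOver-*ʳ c (weight 𝒫) (drawSequences n) ⟩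
        sumOver (weight 𝒫) (drawSequences n) * c          ≈⟨ *-congʳ (Σweight≈1 n) ⟩
        1# * c                                            ≈⟨ *-identityˡ c ⟩
        c                                                 ∎

      -- Linearity of expectation: each of the n draws has law `𝒫`. The induction splits off the
      -- first draw and uses that the weights of the others sum to 1.
      𝔼-sumᵛ : ∀ n f → 𝔼 {n} (sumᵛ f) ≈ fromℕ n * sum (λ x → p x * f x)
      𝔼-sumᵛ n f = trans (go n) (*-congˡ (sumOver-allFin (λ x → p x * f x)))
        where
        open Solver
        pf = λ x → p x * f x
        μ = sumOver pf (allFin u)
        go : ∀ n → 𝔼 {n} (sumᵛ f) ≈ fromℕ n * μ
        go zero    = trans (+-identityʳ _) (trans (zeroʳ 1#) (sym (zeroˡ μ)))
        go (suc n) = begin-equality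
          𝔼 {suc n} (sumᵛ f)
            ≈⟨ sumOver-cartesianProductWith _ _∷_ (allFin u) (drawSequences n) ⟩
          sumOver (λ x → sumOver (λ v → p x * weight 𝒫 v * (f x + sumᵛ f v)) (drawSequences n)) (allFin u)
            ≈⟨ sumOver-cong (λ x → trans
                 (sumOver-cong (λ v → solve 4 (λ p w f t → p :* w :* (f :+ t) := w :* (p :* f) :+ p :* (w :* t)) refl (p x) _ (f x) _) (drawSequences n))
                 (sumOver-+ _ _ (drawSequences n))) (allFin u) ⟩
          sumOver (λ x → 𝔼 {n} (λ _ → pf x) + sumOver (λ v → p x * (weight 𝒫 v * sumᵛ f v)) (drawSequences n)) (allFin u)
            ≈⟨ sumOver-cong (λ x → +-cong (𝔼-const {n} (pf x)) (sumOver-*ˡ (p x) _ (drawSequences n))) (allFin u) ⟩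
          sumOver (λ x → pf x + p x * 𝔼 {n} (sumᵛ f)) (allFin u)
            ≈⟨ sumOver-+ _ _ (allFin u) ⟩
          μ + sumOver (λ x → p x * 𝔼 {n} (sumᵛ f)) (allFin u)
            ≈⟨ +-congˡ (trans (sumOver-*ʳ _ p (allFin u)) (*-cong Σp≈1 (go n))) ⟩
          μ + 1# * (fromℕ n * μ)
            ≈⟨ +-cong (sym (*-identityˡ μ)) (*-identityˡ _) ⟩
          1# * μ + fromℕ n * μ
            ≈⟨ distribʳ μ 1# (fromℕ n) ⟨
          (1# + fromℕ n) * μ ∎

-- Rates r with k = log r.

if-elim : ∀ {P A : Set} (Q : A → Set) (P? : Dec P) {x y} →
  (P → Q x) → (¬ P → Q y) → Q (if does P? then x else y)
if-elim Q (yes p) f g = f p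
if-elim Q (no ¬p) f g = g ¬p

module Rates {ℝ : CompleteOrderedField} (logarithm : BinaryLogarithm ℝ) where
  open OrderedField ℝ
  open LogarithmProperties logarithm
  open Filters ℝ logarithm
  open BinaryLogarithm logarithm using (log-*)
  open FiniteSums logarithm
  open ≤-Reasoning
  open MinOp (Min.minOperator totalOrder) using (x≤y⊓z⇒x≤y; x≤y⊓z⇒x≤z)

  module Tilt {u : ℕ} (𝒫 : Distribution u) (n : ℕ) (𝒬 : Distribution u) (ε : Carrier) where
    open Distribution 𝒫 renaming (mass to p; nonneg to 0≤p) using ()
    open Distribution 𝒬 renaming (mass to q) using ()

    -- r plays the role of 2 ^ k_x.
    data Rate (x : Fin u) (κ : Carrier) : Set where
      trivial : κ ≡ 0# → Rate x κ
      proper  : ∀ r → 1# ≤ r → κ ≈ log r → fromℕ n * (p x * r) ≤ 1# → ε * (p x * r) ≤ q x → Rate x κ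

    module _ (1≤n : 1 ℕ.≤ n) (0<ε : 0# < ε) (ε<1 : ε < 1#) where
      open Solver using (solve; _:*_; _:=_)

      private
        N = fromℕ n
        0<N = fromℕ-pos 1≤n

      -- In the three nonzero cases p r equals q / ε, p / ε and 1 / n respectively, and the
      -- conditions of the case say that this is at most both 1 / n and q / ε.
      rate : ∀ x → Rate x (k 𝒫 n 𝒬 ε x)
      rate x =
        if-elim (Rate x) (1# / N <? p x ⊎-dec q x ≤? ε * p x) (λ _ → trivial ≡.refl) λ _ →
        if-elim (Rate x) (ε * p x <? q x ×-dec q x ≤? p x ⊓ (ε / N)) case₂ λ _ →
        if-elim (Rate x) (p x <? q x ×-dec p x ≤? ε / N) case₃ λ _ →
        if-elim (Rate x) (ε / N <? q x ×-dec (ε / N <? p x ×-dec p x ≤? 1# / N)) case₄ λ _ →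
        -- The default value of `k` is 0, which the trivial rate covers.
        trivial ≡.refl
        where
        -- Shared by the second and third cases, with m = q and m = p: since m = ε p r, both
        -- constraints on p r become upper bounds on m.
        proper′ : ∀ {r m} → 1# ≤ r → p x * r ≈ m / ε → m ≤ q x → m ≤ ε / N → Rate x (log r)
        proper′ {r} {m} 1≤r pr≈m/ε m≤q m≤ε/N = proper r 1≤r refl
          (begin
            N * (p x * r)   ≈⟨ *-congˡ pr≈m/ε ⟩
            N * (m / ε)     ≈⟨ *-assoc N m (ε ⁻¹) ⟨
            N * m / ε       ≤⟨ y≤x*z⇒y/z≤x 0<ε (begin
              N * m           ≈⟨ *-comm N m ⟩
              m * N           ≤⟨ x≤y/z⇒x*z≤y 0<N m≤ε/N ⟩
              ε               ≈⟨ *-identityˡ ε ⟨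
              1# * ε          ∎) ⟩
            1#              ∎)
          (begin
            ε * (p x * r)   ≈⟨ *-comm ε _ ⟩
            p x * r * ε     ≈⟨ *-congʳ pr≈m/ε ⟩
            m / ε * ε       ≈⟨ /-cancelʳ m 0<ε ⟩
            m               ≤⟨ m≤q ⟩
            q x             ∎)

        case₂ : ε * p x < q x × q x ≤ p x ⊓ (ε / N) → Rate x (log (1# / ε * (q x / p x)))
        case₂ (εp<q , q≤p⊓ε/N) = proper′ 1≤r pr≈q/ε ≤-refl (x≤y⊓z⇒x≤z _ _ q≤p⊓ε/N)
          where
          0<p : 0# < p x
          0<p = <-≤-trans (≤-<-trans (*-nonneg (<⇒≤ 0<ε) (0≤p x)) εp<q) (x≤y⊓z⇒x≤y _ _ q≤p⊓ε/N)
          pr≈q/ε : p x * (1# / ε * (q x / p x)) ≈ q x / ε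
          pr≈q/ε = begin-equality
            p x * (1# / ε * (q x / p x))
              ≈⟨ solve 5 (λ p o e q i → p :* (o :* e :* (q :* i)) := o :* (q :* e :* (p :* i))) refl (p x) 1# (ε ⁻¹) (q x) (p x ⁻¹) ⟩
            1# * (q x / ε * (p x * p x ⁻¹))
              ≈⟨ trans (*-identityˡ _) (*-congˡ (*-inverseʳ 0<p)) ⟩
            q x / ε * 1#
              ≈⟨ *-identityʳ _ ⟩
            q x / ε ∎
          1≤r : 1# ≤ 1# / ε * (q x / p x)
          1≤r = *-cancelʳ-≤ 0<p (begin
            1# * p x                     ≈⟨ *-identityˡ _ ⟩
            p x                          ≤⟨ x*z≤y⇒x≤y/z 0<ε (≤-respˡ-≈ (*-comm ε (p x)) (<⇒≤ εp<q)) ⟩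
            q x / ε                      ≈⟨ pr≈q/ε ⟨
            p x * (1# / ε * (q x / p x)) ≈⟨ *-comm (p x) _ ⟩
            1# / ε * (q x / p x) * p x   ∎)

        case₃ : p x < q x × p x ≤ ε / N → Rate x (log (1# / ε))
        case₃ (p<q , p≤ε/N) = proper′ (x*z≤y⇒x≤y/z 0<ε (≤-respˡ-≈ (sym (*-identityˡ ε)) (<⇒≤ ε<1)))
          (*-congˡ (*-identityˡ (ε ⁻¹))) (<⇒≤ p<q) p≤ε/N

        case₄ : ε / N < q x × ε / N < p x × p x ≤ 1# / N → Rate x (log (1# / (N * p x)))
        -- Here N p r = 1 exactly, so after multiplication by N the second constraint reads ε ≤ q N.
        case₄ (ε/N<q , ε/N<p , p≤1/N) = proper r 1≤r refl (≤-reflexive Npr≈1) (*-cancelʳ-≤ 0<N (begin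
            ε * (p x * r) * N    ≈⟨ solve 4 (λ e p r n → e :* (p :* r) :* n := e :* (n :* (p :* r))) refl ε (p x) r N ⟩
            ε * (N * (p x * r))  ≈⟨ *-congˡ Npr≈1 ⟩
            ε * 1#               ≈⟨ *-identityʳ ε ⟩
            ε                    ≈⟨ /-cancelʳ ε 0<N ⟨
            ε / N * N            ≤⟨ *-monoˡ-≤ (<⇒≤ 0<N) (<⇒≤ ε/N<q) ⟩
            q x * N              ∎))
          where
          r = 1# / (N * p x)
          0<Np : 0# < N * p x
          0<Np = *-pos 0<N (≤-<-trans (<⇒≤ (/-pos 0<ε 0<N)) ε/N<p)
          Npr≈1 : N * (p x * r) ≈ 1#
          Npr≈1 = begin-equality
            N * (p x * r)            ≈⟨ *-assoc N (p x) r ⟨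
            N * p x * r              ≈⟨ *-comm _ r ⟩
            1# / (N * p x) * (N * p x) ≈⟨ /-cancelʳ 1# 0<Np ⟩
            1#                       ∎
          1≤r : 1# ≤ r
          1≤r = x*z≤y⇒x≤y/z 0<Np (begin
            1# * (N * p x)  ≈⟨ trans (*-identityˡ _) (*-comm N (p x)) ⟩
            p x * N         ≤⟨ x≤y/z⇒x*z≤y 0<N p≤1/N ⟩
            1#              ∎)

    module _ {x : Fin u} {κ : Carrier} where

      ratio : Rate x κ → Carrier
      ratio (trivial _)        = 1#
      ratio (proper r _ _ _ _) = r

      -- This is z. In the trivial case it is 0 and not p, because there p may exceed 1 / n or q /
      -- ε.
      excess : Rate x κ → Carrier
      excess (trivial _)        = 0#
      excess (proper r _ _ _ _) = p x * r

      -- The correction for draws outside `T`. In the trivial case `κ` is 0, hence at most log u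
      -- without correction, whereas the value 1 / u could have a large mean because n p may exceed
      -- 1.
      surplus : Rate x κ → Carrier
      surplus (trivial _)        = 0#
      surplus (proper r _ _ _ _) = r / fromℕ u

      1≤ratio : ∀ R → 1# ≤ ratio R
      1≤ratio (trivial _)          = ≤-refl
      1≤ratio (proper _ 1≤r _ _ _) = 1≤r

      κ≈log-ratio : ∀ R → κ ≈ log (ratio R)
      κ≈log-ratio (trivial ≡.refl)    = sym log-1
      κ≈log-ratio (proper _ _ κ≈ _ _) = κ≈

      κ-nonneg : Rate x κ → 0# ≤ κ
      κ-nonneg R = ≤-respʳ-≈ (sym (κ≈log-ratio R)) (log-nonneg (1≤ratio R))

      excess-nonneg : ∀ R → 0# ≤ excess R
      excess-nonneg (trivial _)          = ≤-refl
      excess-nonneg (proper _ 1≤r _ _ _) = *-nonneg (0≤p x) (≤-trans 0≤1 1≤r)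

      -- The summand p pays for the trivial case, where r = 1, and the excess pays for the proper
      -- one.
      p*ratio≤p+excess : ∀ R b → p x * (ratio R when b) ≤ p x + (excess R when b)
      p*ratio≤p+excess R false = ≤-trans (≤-reflexive (zeroʳ _)) (+-nonneg (0≤p x) ≤-refl)
      p*ratio≤p+excess (trivial _) true = ≤-reflexive (trans (*-identityʳ _) (sym (+-identityʳ _)))
      p*ratio≤p+excess (proper _ _ _ _ _) true = x≤y+x (0≤p x)

      N*excess≤1 : ∀ R → fromℕ n * excess R ≤ 1#
      N*excess≤1 (trivial _)         = ≤-trans (≤-reflexive (zeroʳ _)) 0≤1
      N*excess≤1 (proper _ _ _ ≤1 _) = ≤1

      ε*excess≤q : ∀ R → ε * excess R ≤ q x
      ε*excess≤q (trivial _)         = ≤-trans (≤-reflexive (zeroʳ _)) (Distribution.nonneg 𝒬 x)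
      ε*excess≤q (proper _ _ _ _ ≤q) = ≤q

      module _ (2≤u : 2 ℕ.≤ u) where
        private
          U = fromℕ u
          0<U = fromℕ-pos (ℕₚ.≤-trans (s≤s z≤n) 2≤u)

        surplus-nonneg : ∀ R → 0# ≤ surplus R
        surplus-nonneg (trivial _)          = ≤-refl
        surplus-nonneg (proper _ 1≤r _ _ _) = <⇒≤ (/-pos (<-≤-trans 0<1 1≤r) 0<U)

        -- Writing r = u (r / u) separates a uniform cost log u from a factor whose logarithm is at
        -- most r / u.
        κ≤log-u+surplus : ∀ R → κ ≤ log U + surplus R
        κ≤log-u+surplus (trivial ≡.refl) = +-nonneg (≤-trans 0≤1 (1≤log-fromℕ 2≤u)) ≤-refl
        κ≤log-u+surplus (proper r 1≤r κ≈ _ _) = begin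
          κ                    ≈⟨ κ≈ ⟩
          log r                ≈⟨ log-cong 0<r (trans (sym (/-cancelʳ r 0<U)) (*-comm _ U)) ⟩
          log (U * (r / U))    ≈⟨ log-* 0<U 0<r/U ⟩
          log U + log (r / U)  ≤⟨ +-monoʳ-≤ _ (log-≤ 0<r/U) ⟩
          log U + r / U        ∎
          where
          0<r = <-≤-trans 0<1 1≤r
          0<r/U = /-pos 0<r 0<U

        N*p*surplus≤1/u : ∀ R → fromℕ n * (p x * surplus R) ≤ 1# / U
        N*p*surplus≤1/u (trivial _) = begin
          fromℕ n * (p x * 0#)  ≈⟨ trans (*-congˡ (zeroʳ _)) (zeroʳ _) ⟩
          0#                    ≤⟨ <⇒≤ (/-pos 0<1 0<U) ⟩
          1# / U                ∎
        N*p*surplus≤1/u (proper r _ _ ≤1 _) = begin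
          fromℕ n * (p x * (r / U)) ≈⟨ solve 4 (λ n p r i → n :* (p :* (r :* i)) := n :* (p :* r) :* i) refl (fromℕ n) (p x) r (U ⁻¹) ⟩
          fromℕ n * (p x * r) / U   ≤⟨ *-monoˡ-≤ (<⇒≤ (⁻¹-pos 0<U)) ≤1 ⟩
          1# / U                    ∎
          where open Solver using (solve; _:*_; _:=_)

-- The lower bound for a fixed algorithm.

module LowerBound {ℝ : CompleteOrderedField} (logarithm : BinaryLogarithm ℝ) where
  open OrderedField ℝ
  open LogarithmProperties logarithm
  open Filters ℝ logarithm
  open BinaryLogarithm logarithm using (log-*)
  open FiniteSums logarithm
  open Draws logarithm
  open Rates logarithm
  open ≤-Reasoning

  module Bound
    {u : ℕ} (2≤u : 2 ℕ.≤ u) (𝒫 𝒬 : Distribution u)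
    {n : ℕ} (1≤n : 1 ℕ.≤ n) {ε : Carrier} (0<ε : 0# < ε) (ε<1 : ε < 1#)
    (A : Algorithm u)
    where
    open Expectation 𝒫
    open Tilt 𝒫 n 𝒬 ε
    open Distribution 𝒫 renaming (mass to p; nonneg to 0≤p) using ()
    open Distribution 𝒬 renaming (mass to q) using ()
    open Algorithm A

    private
      N = fromℕ n
      0<N = fromℕ-pos 1≤n
      Draw = Vec (Fin u) n

    κ : Fin u → Carrier
    κ = k 𝒫 n 𝒬 ε

    R : ∀ x → Rate x (κ x)
    R = rate 1≤n 0<ε ε<1

    r z d : Fin u → Carrier
    r x = ratio (R x)
    z x = excess (R x)
    d x = surplus (R x)

    0<r : ∀ x → 0# < r x
    0<r x = <-≤-trans 0<1 (1≤ratio (R x))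

    0≤z : ∀ x → 0# ≤ z x
    0≤z x = excess-nonneg (R x)

    0≤κ : ∀ x → 0# ≤ κ x
    0≤κ x = κ-nonneg (R x)

    LB≈𝔼 : 𝔼 {n} (sumᵛ κ) ≈ LB 𝒫 n 𝒬 ε
    LB≈𝔼 = 𝔼-sumᵛ n κ

    π : Draw → List Bool → Carrier
    π v = StringDistribution.mass (output (distinct v))

    0≤π : ∀ v I → 0# ≤ π v I
    0≤π v = StringDistribution.nonneg (output (distinct v))

    yes-on : Fin u → List Bool → Bool
    yes-on x I = does (x Subsetₚ.∈? accepts I)

    size : List Bool → Carrier
    size I = fromℕ (length I)

    Z : List Bool → Carrier
    Z I = 1# + sumOver (λ x → z x when yes-on x I) (allFin u)

    1≤Z : ∀ I → 1# ≤ Z I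
    1≤Z I = x≤x+y (sumOver-nonneg (λ x → when-nonneg (yes-on x I) (0≤z x)) (allFin u))

    0<Z : ∀ I → 0# < Z I
    0<Z I = <-≤-trans 0<1 (1≤Z I)

    -- The leading 1 of `Z I` is the total mass of `𝒫`, which covers the trivial rates however many
    -- of them `I` accepts.
    Σpr≤Z : ∀ I → sumOver (λ x → p x * (r x when yes-on x I)) (allFin u) ≤ Z I
    Σpr≤Z I = begin
      sumOver (λ x → p x * (r x when yes-on x I)) (allFin u)
        ≤⟨ sumOver-mono (λ x → p*ratio≤p+excess (R x) (yes-on x I)) (allFin u) ⟩
      sumOver (λ x → p x + (z x when yes-on x I)) (allFin u)
        ≈⟨ sumOver-+ _ _ (allFin u) ⟩
      sumOver p (allFin u) + sumOver (λ x → z x when yes-on x I) (allFin u)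
        ≈⟨ +-congʳ Σp≈1 ⟩
      Z I ∎

    -- For each I, the mean over v of c I * prodᵛ r v, restricted to v ⊆ U_I, is at
    -- most ½ ^ |I|, so by Kraft the sum over all possible instances is at most 1.
    c : List Bool → Carrier
    c I = ½ ^ length I * (Z I ⁻¹) ^ n

    0<c : ∀ I → 0# < c I
    0<c I = *-pos (^-pos (length I) 0<½) (^-pos n (⁻¹-pos (0<Z I)))

    2^Z^c≈1 : ∀ I → 2# ^ length I * Z I ^ n * c I ≈ 1#
    2^Z^c≈1 I = begin-equality
      2# ^ length I * Z I ^ n * (½ ^ length I * (Z I ⁻¹) ^ n)
        ≈⟨ solve 4 (λ a b c d → (a :* b) :* (c :* d) := (a :* c) :* (b :* d)) refl _ _ _ _ ⟩
      2# ^ length I * ½ ^ length I * (Z I ^ n * (Z I ⁻¹) ^ n)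
        ≈⟨ *-cong (2^n*½^n≈1 (length I)) (sym (^-distrib-* _ _ n)) ⟩
      1# * (Z I * Z I ⁻¹) ^ n
        ≈⟨ trans (*-identityˡ _) (^-congˡ n (*-inverseʳ (0<Z I))) ⟩
      1# ^ n
        ≈⟨ 1^n≈1 n ⟩
      1# ∎
      where open Solver

    -- The product of the rates is factored as y times `Z I ^ n` times 2 to the power |I|. The last
    -- factor contributes |I| exactly; for the others log t ≤ t suffices.
    sumᵛκ≤ : ∀ (v : Draw) I → sumᵛ κ v ≤ c I * prodᵛ r v + (N * Z I + size I)
    sumᵛκ≤ v I = begin
      sumᵛ κ v                          ≈⟨ sumOver-cong (λ x → κ≈log-ratio (R x)) (toList v) ⟩
      sumᵛ (log ∘ r) v                  ≈⟨ log-prodᵛ 0<r v ⟨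
      log (prodᵛ r v)                   ≈⟨ log-cong (prodᵛ-pos 0<r v) factor ⟩
      log (y * (Z I ^ n * 2# ^ length I)) ≈⟨ log-* 0<y (*-pos 0<Z^n 0<2^) ⟩
      log y + log (Z I ^ n * 2# ^ length I) ≈⟨ +-congˡ (log-* 0<Z^n 0<2^) ⟩
      log y + (log (Z I ^ n) + log (2# ^ length I))
        ≈⟨ +-congˡ (+-cong (log-^ n (0<Z I)) (log-2^ (length I))) ⟩
      log y + (N * log (Z I) + size I)
        ≤⟨ +-mono₂-≤ (log-≤ 0<y) (+-monoˡ-≤ _ (*-monoʳ-≤ (<⇒≤ 0<N) (log-≤ (0<Z I)))) ⟩
      y + (N * Z I + size I) ∎
      where
      open Solver
      y = c I * prodᵛ r v
      0<y = *-pos (0<c I) (prodᵛ-pos 0<r v)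
      0<Z^n = ^-pos n (0<Z I)
      0<2^ = ^-pos (length I) 0<2
      factor : prodᵛ r v ≈ y * (Z I ^ n * 2# ^ length I)
      factor = begin-equality
        prodᵛ r v                                   ≈⟨ *-identityˡ _ ⟨
        1# * prodᵛ r v                              ≈⟨ *-congʳ (2^Z^c≈1 I) ⟨
        2# ^ length I * Z I ^ n * c I * prodᵛ r v   ≈⟨ solve 4 (λ a b c d → a :* b :* c :* d := (c :* d) :* (b :* a)) refl _ _ _ _ ⟩
        y * (Z I ^ n * 2# ^ length I)               ∎

    -- Prefix-freeness speaks only of instances of positive probability, so Kraft's inequality is
    -- applied to these. Membership is decidable because there are finitely many draw sequences.
    Possible : List Bool → Set
    Possible I = ∃ λ (v : Draw) → 0# < π v I

    possible? : Decidable Possible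
    possible? I with any? (λ v → 0# <? π v I) (drawSequences n)
    ... | yes some = yes (satisfied some)
    ... | no  none = no λ { (v , 0<π) → none (lose (∈-drawSequences v) 0<π) }

    -- Acceptance is tested factor by factor instead of once for all of `v`, so that the expression
    -- remains a product over the draws and `sumOver-prodᵛ` evaluates its mean.
    gain : List Bool → Draw → Carrier
    gain I v = c I * prodᵛ (λ x → r x when yes-on x I) v when does (possible? I)

    gain-nonneg : ∀ I v → 0# ≤ gain I v
    gain-nonneg I v = when-nonneg (does (possible? I))
      (*-nonneg (<⇒≤ (0<c I)) (prodᵛ-nonneg (λ x → when-nonneg (yes-on x I) (<⇒≤ (0<r x))) v))

    -- The mean of the truncated product is the n-th power of a sum that is at most `Z I`, and `c I`
    -- contains the inverse of `Z I ^ n`.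
    𝔼-gain : ∀ I → 𝔼 (gain I) ≤ (½ ^ length I when does (possible? I))
    𝔼-gain I = begin
      𝔼 (gain I)
        ≈⟨ sumOver-cong (λ v → *-when′ (weight 𝒫 v) _ b) (drawSequences n) ⟩
      -- The test for possible instances does not involve `v`, so it can leave the mean as a factor
      -- 0 or 1.
      𝔼 {n} (λ v → (1# when b) * (c I * prodᵛ f v))
        ≈⟨ trans (𝔼-*ˡ {n} _ _) (*-congˡ (𝔼-*ˡ {n} (c I) (prodᵛ f))) ⟩
      (1# when b) * (c I * 𝔼 {n} (prodᵛ f))
        ≈⟨ *-congˡ (*-congˡ (trans
             (sumOver-cong (λ v → sym (prodᵛ-* p f v)) (drawSequences n))
             (sumOver-prodᵛ (λ x → p x * f x) n))) ⟩
      (1# when b) * (c I * sumOver (λ x → p x * f x) (allFin u) ^ n)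
        ≤⟨ *-monoʳ-≤ (when-nonneg b 0≤1) (*-monoʳ-≤ (<⇒≤ (0<c I))
             (^-mono-≤ n (sumOver-nonneg 0≤pf (allFin u)) (Σpr≤Z I))) ⟩
      (1# when b) * (½ ^ length I * (Z I ⁻¹) ^ n * Z I ^ n)
        ≈⟨ *-congˡ (trans (*-assoc _ _ _) (trans (*-congˡ cancel) (*-identityʳ _))) ⟩
      (1# when b) * ½ ^ length I
        ≈⟨ trans (*-comm _ _) (trans (*-when _ 1# b) (when-cong b (*-identityʳ _))) ⟩
      (½ ^ length I when b) ∎
      where
      b = does (possible? I)
      f = λ x → r x when yes-on x I
      0≤pf : ∀ x → 0# ≤ p x * f x
      0≤pf x = *-nonneg (0≤p x) (when-nonneg (yes-on x I) (<⇒≤ (0<r x)))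
      when-cong : ∀ {x y} b → x ≈ y → (x when b) ≈ (y when b)
      when-cong true  x≈y = x≈y
      when-cong false x≈y = refl
      *-when′ : ∀ w y b → w * (y when b) ≈ w * ((1# when b) * y)
      *-when′ w y true  = *-congˡ (sym (*-identityˡ y))
      *-when′ w y false = *-congˡ (sym (zeroˡ y))
      cancel : (Z I ⁻¹) ^ n * Z I ^ n ≈ 1#
      cancel = begin-equality
        (Z I ⁻¹) ^ n * Z I ^ n   ≈⟨ ^-distrib-* _ _ n ⟨
        (Z I ⁻¹ * Z I) ^ n     ≈⟨ ^-congˡ n (trans (*-comm _ _) (*-inverseʳ (0<Z I))) ⟩
        1# ^ n                 ≈⟨ 1^n≈1 n ⟩
        1#                     ∎

    -- Two possible instances may stem from different input sets; `prefixFree` compares outputs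
    -- across inputs.
    possible-incomparable : ∀ {L} → Unique L → AllPairs Incomparable (filter possible? L)
    possible-incomparable {L} L! = go (all-filter possible? L) (Uniqueₚ.filter⁺ possible? L!)
      where
      go : ∀ {M} → All Possible M → Unique M → AllPairs Incomparable M
      go []                       []         = []
      go {I ∷ M} ((v , 0<πI) ∷ poss) (I∉ ∷ M!) = All.map incomparable (All.zip (poss , I∉)) ∷ go poss M!
        where
        incomparable : ∀ {J} → Possible J × I ≢ J → Incomparable I J
        incomparable ((w , 0<πJ) , I≢J) =
          (λ I≼J → I≢J (prefixFree (distinct v) (distinct w) _ _ 0<πI 0<πJ I≼J)) ,
          (λ J≼I → I≢J (≡.sym (prefixFree (distinct w) (distinct v) _ _ 0<πJ 0<πI J≼I)))

    𝔼-Σgain : ∀ {L} → Unique L → 𝔼 (λ v → sumOver (λ I → gain I v) L) ≤ 1#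
    𝔼-Σgain {L} L! = begin
      𝔼 (λ v → sumOver (λ I → gain I v) L)
        ≈⟨ sumOver-cong (λ v → sumOver-*ˡ (weight 𝒫 v) (λ I → gain I v) L) (drawSequences n) ⟨
      sumOver (λ v → sumOver (λ I → weight 𝒫 v * gain I v) L) (drawSequences n)
        ≈⟨ sumOver-swap (λ v I → weight 𝒫 v * gain I v) (drawSequences n) L ⟩
      sumOver (λ I → 𝔼 (gain I)) L
        ≤⟨ sumOver-mono 𝔼-gain L ⟩
      sumOver (λ I → ½ ^ length I when does (possible? I)) L
        ≈⟨ sumOver-filter possible? (λ I → ½ ^ length I) L ⟩
      kraftSum (filter possible? L)
        ≤⟨ kraft (possible-incomparable L!) ⟩
      1# ∎

    -- Estimates for one draw sequence on whose set `A` is a filter.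

    module _ (v : Draw) (filters : IsFilter 𝒬 ε A (distinct v)) where
      private
        S = distinct v
        pr = proj₁ (proj₂ filters)
        outside = λ x → does (¬? (x Subsetₚ.∈? S))
        inside = λ x → does (x Subsetₚ.∈? S)

      Σz-inside : sumOver (λ x → z x when inside x) (allFin u) ≤ 1#
      Σz-inside = begin
        sumOver (λ x → z x when inside x) (allFin u) ≤⟨ sum-distinct 0≤z v ⟩
        sumᵛ z v                                     ≤⟨ sumOver-bounded z≤1/N (toList v) ⟩
        fromℕ (length (toList v)) * (1# / N)         ≡⟨ ≡.cong (λ m → fromℕ m * (1# / N)) (Vecₚ.length-toList v) ⟩
        N * (1# / N)                                 ≈⟨ trans (*-comm _ _) (/-cancelʳ 1# 0<N) ⟩
        1#                                           ∎
        where
        z≤1/N : ∀ x → z x ≤ 1# / N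
        z≤1/N x = x*z≤y⇒x≤y/z 0<N (≤-respˡ-≈ (*-comm _ _) (N*excess≤1 (R x)))

      -- The empty list is a partial sum of value 0, and `pr x` bounds all partial sums.
      0≤pr : ∀ x → 0# ≤ pr x
      0≤pr x = proj₁ (proj₁ (proj₂ (proj₂ filters)) x) 0# ([] , [] , refl)

      -- After multiplication by ε each z is at most q, and the sum is at most the false positive
      -- rate of the filter.
      Σz-outside : sumOver (λ x → z x * pr x when outside x) (allFin u) ≤ 1#
      Σz-outside = *-cancelʳ-≤ 0<ε (begin
        sumOver (λ x → z x * pr x when outside x) (allFin u) * ε
          ≈⟨ trans (*-comm _ ε) (sym (sumOver-*ˡ ε _ (allFin u))) ⟩
        sumOver (λ x → ε * (z x * pr x when outside x)) (allFin u)
          ≤⟨ sumOver-mono bound (allFin u) ⟩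
        sumOver (λ x → q x * pr x when outside x) (allFin u)
          ≈⟨ sumOver-allFin (λ x → q x * pr x when outside x) ⟩
        sum (λ x → q x * pr x when outside x)
          ≤⟨ proj₂ (proj₂ (proj₂ filters)) ⟩
        ε
          ≈⟨ *-identityˡ ε ⟨
        1# * ε ∎)
        where
        bound : ∀ x → ε * (z x * pr x when outside x) ≤ (q x * pr x when outside x)
        bound x = begin
          ε * (z x * pr x when outside x)   ≈⟨ *-when ε _ (outside x) ⟩
          (ε * (z x * pr x) when outside x) ≤⟨ when-mono (outside x) (begin
            ε * (z x * pr x)                  ≈⟨ *-assoc ε (z x) (pr x) ⟨
            ε * z x * pr x                    ≤⟨ *-monoˡ-≤ (0≤pr x) (ε*excess≤q (R x)) ⟩
            q x * pr x                        ∎) ⟩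
          (q x * pr x when outside x)       ∎

      -- One unit each for the total mass, the elements of S and the elements outside S. The
      -- probability of YES is bounded by 1 on S and by `pr` elsewhere.
      ΣπZ≤3 : ∀ {L} → Unique L → sumOver (λ I → π v I * Z I) L ≤ fromℕ 3
      ΣπZ≤3 {L} L! = begin
        sumOver (λ I → π v I * Z I) L
          ≈⟨ sumOver-cong expand L ⟩
        sumOver (λ I → π v I + sumOver (λ x → z x * (π v I when yes-on x I)) (allFin u)) L
          ≈⟨ sumOver-+ _ _ L ⟩
        sumOver (π v) L + sumOver (λ I → sumOver (λ x → z x * (π v I when yes-on x I)) (allFin u)) L
          ≈⟨ +-congˡ (sumOver-swap _ L (allFin u)) ⟩
        sumOver (π v) L + sumOver (λ x → sumOver (λ I → z x * (π v I when yes-on x I)) L) (allFin u)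
          ≤⟨ +-mono₂-≤ (partial-≤1 D L!) (sumOver-mono split (allFin u)) ⟩
        1# + sumOver (λ x → (z x when inside x) + (z x * pr x when outside x)) (allFin u)
          ≈⟨ +-congˡ (sumOver-+ _ _ (allFin u)) ⟩
        1# + (sumOver (λ x → z x when inside x) (allFin u) + sumOver (λ x → z x * pr x when outside x) (allFin u))
          ≤⟨ +-monoʳ-≤ 1# (+-mono₂-≤ Σz-inside Σz-outside) ⟩
        1# + (1# + 1#)
          ≈⟨ +-congˡ (+-congˡ (+-identityʳ 1#)) ⟨
        fromℕ 3 ∎
        where
        D = output S
        expand : ∀ I → π v I * Z I ≈ π v I + sumOver (λ x → z x * (π v I when yes-on x I)) (allFin u)
        expand I = begin-equality
          π v I * Z I
            ≈⟨ trans (distribˡ _ _ _) (+-cong (*-identityʳ _) (sym (sumOver-*ˡ (π v I) _ (allFin u)))) ⟩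
          π v I + sumOver (λ x → π v I * (z x when yes-on x I)) (allFin u)
            ≈⟨ +-congˡ (sumOver-cong (λ x → exchange (yes-on x I)) (allFin u)) ⟩
          π v I + sumOver (λ x → z x * (π v I when yes-on x I)) (allFin u) ∎
          where
          exchange : ∀ {x y} b → x * (y when b) ≈ y * (x when b)
          exchange true  = *-comm _ _
          exchange false = trans (zeroʳ _) (sym (zeroʳ _))
        split : ∀ x → sumOver (λ I → z x * (π v I when yes-on x I)) L ≤
          (z x when inside x) + (z x * pr x when outside x)
        split x with x Subsetₚ.∈? S
        ... | yes _ = begin
          sumOver (λ I → z x * (π v I when yes-on x I)) L
            ≈⟨ sumOver-*ˡ (z x) _ L ⟩
          z x * sumOver (λ I → π v I when yes-on x I) L
            ≤⟨ *-monoʳ-≤ (0≤z x) (≤-trans (sumOver-mono (λ I → when-≤ (yes-on x I) (0≤π v I)) L) (partial-≤1 D L!)) ⟩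
          z x * 1#
            ≈⟨ trans (*-identityʳ _) (sym (+-identityʳ _)) ⟩
          z x + 0# ∎
        ... | no  _ = begin
          sumOver (λ I → z x * (π v I when yes-on x I)) L
            ≈⟨ sumOver-*ˡ (z x) _ L ⟩
          z x * sumOver (λ I → π v I when yes-on x I) L
            ≤⟨ *-monoʳ-≤ (0≤z x) (proj₁ (proj₁ (proj₂ (proj₂ filters)) x) _ (L , L! , refl)) ⟩
          z x * pr x
            ≈⟨ +-identityˡ _ ⟨
          0# + z x * pr x ∎

      accepted : ∀ {I} → 0# < π v I → ∀ {x} → x ∈ toList v → yes-on x I ≡ true
      accepted 0<π {x} x∈v = certain (output S) (yes-on x) (proj₁ filters x (distinct⁺ v x∈v)) 0<π

      π*sumᵛκ≤ : ∀ I → π v I * sumᵛ κ v ≤ gain I v + (N * (π v I * Z I) + π v I * size I)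
      π*sumᵛκ≤ I with 0# <? π v I
      ... | yes 0<π = begin
        π v I * sumᵛ κ v
          ≤⟨ *-monoʳ-≤ (0≤π v I) (sumᵛκ≤ v I) ⟩
        π v I * (c I * prodᵛ r v + (N * Z I + size I))
          ≈⟨ solve 5 (λ π y n Z s → π :* (y :+ (n :* Z :+ s)) := π :* y :+ (n :* (π :* Z) :+ π :* s)) refl (π v I) _ N (Z I) (size I) ⟩
        π v I * (c I * prodᵛ r v) + (N * (π v I * Z I) + π v I * size I)
          ≤⟨ +-monoˡ-≤ _ (begin
            -- The factor π ≤ 1 is given up, since Kraft's inequality bounds the unweighted sum of
            -- the gains.
            π v I * (c I * prodᵛ r v) ≤⟨ *-monoˡ-≤ (<⇒≤ (*-pos (0<c I) (prodᵛ-pos 0<r v))) (mass-≤1 (output S) I) ⟩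
            1# * (c I * prodᵛ r v)    ≈⟨ *-identityˡ _ ⟩
            -- An instance of positive probability accepts every draw in `v`, so the truncation
            -- changes no factor.
            c I * prodᵛ r v           ≈⟨ *-congˡ (prodᵛ-when r (λ x → yes-on x I) v (accepted 0<π)) ⟨
            c I * prodᵛ (λ x → r x when yes-on x I) v
              ≡⟨ ≡.cong (c I * prodᵛ (λ x → r x when yes-on x I) v when_) (dec-true (possible? I) (v , 0<π)) ⟨
            gain I v                  ∎) ⟩
        gain I v + (N * (π v I * Z I) + π v I * size I) ∎
        where open Solver
      ... | no  0≮π = begin
        π v I * sumᵛ κ v  ≤⟨ *-monoˡ-≤ (sumOver-nonneg 0≤κ (toList v)) (≮⇒≥ 0≮π) ⟩
        0# * sumᵛ κ v     ≈⟨ zeroˡ _ ⟩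
        0#                ≤⟨ +-nonneg (gain-nonneg I v) (+-nonneg
                               (*-nonneg (<⇒≤ 0<N) (*-nonneg (0≤π v I) (<⇒≤ (0<Z I))))
                               (*-nonneg (0≤π v I) (fromℕ-nonneg (length I)))) ⟩
        gain I v + (N * (π v I * Z I) + π v I * size I) ∎

      Σπ*sumᵛκ≤ : ∀ {L} → Unique L → sumOver (π v) L * sumᵛ κ v ≤
        sumOver (λ I → gain I v) L + (N * fromℕ 3 + sumOver (λ I → π v I * size I) L)
      Σπ*sumᵛκ≤ {L} L! = begin
        sumOver (π v) L * sumᵛ κ v
          ≈⟨ sumOver-*ʳ (sumᵛ κ v) (π v) L ⟨
        sumOver (λ I → π v I * sumᵛ κ v) L
          ≤⟨ sumOver-mono π*sumᵛκ≤ L ⟩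
        sumOver (λ I → gain I v + (N * (π v I * Z I) + π v I * size I)) L
          ≈⟨ trans (sumOver-+ _ _ L) (+-congˡ (trans (sumOver-+ _ _ L) (+-congʳ (sumOver-*ˡ N _ L)))) ⟩
        sumOver (λ I → gain I v) L + (N * sumOver (λ I → π v I * Z I) L + sumOver (λ I → π v I * size I) L)
          ≤⟨ +-monoʳ-≤ _ (+-monoˡ-≤ _ (*-monoʳ-≤ (<⇒≤ 0<N) (ΣπZ≤3 L!))) ⟩
        sumOver (λ I → gain I v) L + (N * fromℕ 3 + sumOver (λ I → π v I * size I) L) ∎

    -- Draws outside `T`, averaging and the final bound.

    module _ (T : Pred (Subset u) 0ℓ) (T? : Decidable T)
      (rare : prOutside 𝒫 n T? ≤ 1# / log (fromℕ u))
      (filters : ∀ S → T S → IsFilter 𝒬 ε A S)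
      {e : Carrier} (expectedSize : IsExpectedSize 𝒫 n A e) where

      private
        U = fromℕ u
        lb = LB 𝒫 n 𝒬 ε
        0<log-u = <-≤-trans 0<1 (1≤log-fromℕ 2≤u)
        bad : Draw → Bool
        bad v = does (¬? (T? (distinct v)))

      0≤d : ∀ x → 0# ≤ d x
      0≤d x = surplus-nonneg 2≤u (R x)

      0≤lb : 0# ≤ lb
      0≤lb = begin
        0#            ≈⟨ 𝔼-const {n} 0# ⟨
        𝔼 {n} (λ _ → 0#) ≤⟨ 𝔼-mono {n} (λ v → sumOver-nonneg 0≤κ (toList v)) ⟩
        𝔼 {n} (sumᵛ κ) ≈⟨ LB≈𝔼 ⟩
        lb            ∎

      -- The mass missed by a finite list of instances costs δ times `lb` on average, so δ is chosen
      -- to make this at most 1. The summand 1 keeps the denominator positive when `lb` is 0.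
      δ : Carrier
      δ = 1# / (1# + lb)

      0<1+lb : 0# < 1# + lb
      0<1+lb = <-≤-trans 0<1 (x≤x+y 0≤lb)

      0<δ : 0# < δ
      0<δ = /-pos 0<1 0<1+lb

      δ*lb≤1 : δ * lb ≤ 1#
      δ*lb≤1 = begin
        δ * lb         ≤⟨ *-monoʳ-≤ (<⇒≤ 0<δ) (x≤y+x 0≤1) ⟩
        δ * (1# + lb)  ≈⟨ /-cancelʳ 1# 0<1+lb ⟩
        1#             ∎

      sumᵛκ≤bad : ∀ (v : Draw) → sumᵛ κ v ≤ N * log U + sumᵛ d v
      sumᵛκ≤bad v = begin
        sumᵛ κ v
          ≤⟨ sumOver-mono (λ x → κ≤log-u+surplus 2≤u (R x)) (toList v) ⟩
        sumᵛ (λ x → log U + d x) v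
          ≈⟨ sumOver-+ _ _ (toList v) ⟩
        sumᵛ (λ _ → log U) v + sumᵛ d v
          ≤⟨ +-monoˡ-≤ _ (sumOver-bounded (λ _ → ≤-refl) (toList v)) ⟩
        fromℕ (length (toList v)) * log U + sumᵛ d v
          ≡⟨ ≡.cong (λ m → fromℕ m * log U + sumᵛ d v) (Vecₚ.length-toList v) ⟩
        N * log U + sumᵛ d v ∎

      module _ {L : List (List Bool)} (L! : Unique L)
        (big : ∀ v → 1# ≤ sumOver (π v) L + δ) where

        -- `bound` adds up the terms for both cases, S in `T` or not; either case discards the
        -- nonnegative terms of the other. Only `penalty` carries the indicator of the rare event:
        -- the mean of `sumᵛ d` is small even over all draws.
        gains sizes penalty bound : Draw → Carrier
        gains v = sumOver (λ I → gain I v) L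
        sizes v = sumOver (λ I → π v I * size I) L
        penalty v = N * log U * (1# when bad v)
        bound v = gains v + (N * fromℕ 3 + sizes v) + δ * sumᵛ κ v + (penalty v + sumᵛ d v)

        sumᵛκ≤bound : ∀ v → sumᵛ κ v ≤ bound v
        sumᵛκ≤bound v with T? (distinct v)
        ... | yes Tv = begin
          sumᵛ κ v
            ≈⟨ *-identityˡ _ ⟨
          1# * sumᵛ κ v
            -- Divides the sum into the share of the instances in `L` and an error of at most δ
            -- times the sum.
            ≤⟨ *-monoˡ-≤ 0≤Σκ (big v) ⟩
          (sumOver (π v) L + δ) * sumᵛ κ v
            ≈⟨ distribʳ _ _ _ ⟩
          sumOver (π v) L * sumᵛ κ v + δ * sumᵛ κ v
            ≤⟨ +-monoˡ-≤ _ (Σπ*sumᵛκ≤ v (filters (distinct v) Tv) L!) ⟩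
          gains v + (N * fromℕ 3 + sizes v) + δ * sumᵛ κ v
            ≤⟨ x≤x+y (+-nonneg (≤-reflexive (sym (zeroʳ _))) (sumOver-nonneg 0≤d (toList v))) ⟩
          gains v + (N * fromℕ 3 + sizes v) + δ * sumᵛ κ v + (N * log U * 0# + sumᵛ d v) ∎
          where
          0≤Σκ = sumOver-nonneg 0≤κ (toList v)
        ... | no _ = begin
          sumᵛ κ v
            ≤⟨ sumᵛκ≤bad v ⟩
          N * log U + sumᵛ d v
            ≈⟨ +-congʳ (*-identityʳ _) ⟨
          N * log U * 1# + sumᵛ d v
            ≤⟨ x≤y+x (+-nonneg (+-nonneg
                 (sumOver-nonneg (λ I → gain-nonneg I v) L)
                 (+-nonneg (*-nonneg (<⇒≤ 0<N) (fromℕ-nonneg 3))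
                   (sumOver-nonneg (λ I → *-nonneg (0≤π v I) (fromℕ-nonneg (length I))) L)))
                 (*-nonneg (<⇒≤ 0<δ) (sumOver-nonneg 0≤κ (toList v)))) ⟩
          gains v + (N * fromℕ 3 + sizes v) + δ * sumᵛ κ v + (N * log U * 1# + sumᵛ d v) ∎

        -- The pairs of a draw sequence and an instance in `L` are distinct, so this is a partial
        -- sum of the joint series whose supremum is `e`.
        𝔼-sizes : 𝔼 sizes ≤ e
        𝔼-sizes = begin
          𝔼 sizes
            ≈⟨ sumOver-cong (λ v → sumOver-*ˡ (weight 𝒫 v) _ L) (drawSequences n) ⟨
          sumOver (λ v → sumOver (λ I → weight 𝒫 v * (π v I * size I)) L) (drawSequences n)
            ≈⟨ sumOver-cartesianProductWith _ _,_ (drawSequences n) L ⟨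
          sumOver _ (cartesianProduct (drawSequences n) L)
            ≤⟨ proj₁ expectedSize _ (_ , Uniqueₚ.cartesianProduct⁺ (drawSequences-unique n) L! , refl) ⟩
          e ∎

        𝔼-penalty : 𝔼 penalty ≤ N
        𝔼-penalty = begin
          𝔼 penalty
            ≈⟨ 𝔼-*ˡ {n} (N * log U) (λ v → 1# when bad v) ⟩
          N * log U * 𝔼 {n} (λ v → 1# when bad v)
            ≈⟨ *-congˡ (sumOver-cong (λ v → weight-when (weight 𝒫 v) (bad v)) (drawSequences n)) ⟩
          N * log U * prOutside 𝒫 n T?
            ≤⟨ *-monoʳ-≤ (*-nonneg (<⇒≤ 0<N) (<⇒≤ 0<log-u)) rare ⟩
          N * log U * (1# / log U)
            ≈⟨ trans (*-assoc _ _ _) (*-congˡ (trans (*-comm _ _) (/-cancelʳ 1# 0<log-u))) ⟩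
          N * 1#
            ≈⟨ *-identityʳ N ⟩
          N ∎
          where
          weight-when : ∀ w b → w * (1# when b) ≈ (w when b)
          weight-when w true  = *-identityʳ w
          weight-when w false = zeroʳ w

        𝔼-d : 𝔼 {n} (sumᵛ d) ≤ 1#
        𝔼-d = begin
          𝔼 {n} (sumᵛ d)
            ≈⟨ trans (𝔼-sumᵛ n d) (*-congˡ (sym (sumOver-allFin (λ x → p x * d x)))) ⟩
          N * sumOver (λ x → p x * d x) (allFin u)
            ≈⟨ sumOver-*ˡ N _ (allFin u) ⟨
          sumOver (λ x → N * (p x * d x)) (allFin u)
            ≤⟨ sumOver-bounded (λ x → N*p*surplus≤1/u 2≤u (R x)) (allFin u) ⟩
          fromℕ (length (allFin u)) * (1# / U)
            ≡⟨ ≡.cong (λ m → fromℕ m * (1# / U)) (Listₚ.length-tabulate {n = u} (id {A = Fin u})) ⟩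
          U * (1# / U)
            ≈⟨ trans (*-comm _ _) (/-cancelʳ 1# (fromℕ-pos (ℕₚ.≤-trans (s≤s z≤n) 2≤u))) ⟩
          1# ∎

        -- The terms are, in order: Kraft's inequality, the mean of Z, the expected size, the mass
        -- missed by `L`, the rare event and its correction.
        𝔼-bound : 𝔼 bound ≤ 1# + (N * fromℕ 3 + e) + 1# + (N + 1#)
        𝔼-bound = begin
          𝔼 bound
            ≈⟨ trans (𝔼-+ {n} _ _) (+-cong
                 (trans (𝔼-+ {n} _ _) (+-cong
                   (trans (𝔼-+ {n} _ _) (+-congˡ (trans (𝔼-+ {n} _ _) (+-congʳ (𝔼-const {n} _)))))
                   (𝔼-*ˡ {n} δ (sumᵛ κ))))
                 (𝔼-+ {n} _ _)) ⟩
          𝔼 gains + (N * fromℕ 3 + 𝔼 sizes) + δ * 𝔼 {n} (sumᵛ κ) + (𝔼 penalty + 𝔼 {n} (sumᵛ d))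
            ≤⟨ +-mono₂-≤
                 (+-mono₂-≤
                   (+-mono₂-≤ (𝔼-Σgain L!) (+-monoʳ-≤ _ 𝔼-sizes))
                   (≤-trans (≤-reflexive (*-congˡ LB≈𝔼)) δ*lb≤1))
                 (+-mono₂-≤ 𝔼-penalty 𝔼-d) ⟩
          1# + (N * fromℕ 3 + e) + 1# + (N + 1#) ∎

        lb≤ : lb ≤ e + fromℕ (6 ℕ.* n) + 1#
        lb≤ = begin
          lb                ≈⟨ LB≈𝔼 ⟨
          𝔼 {n} (sumᵛ κ)    ≤⟨ 𝔼-mono sumᵛκ≤bound ⟩
          𝔼 bound           ≤⟨ 𝔼-bound ⟩
          1# + (N * fromℕ 3 + e) + 1# + (N + 1#)
            ≈⟨ +-congʳ (+-congʳ (+-congˡ (+-congʳ (fromℕ-homo-* n 3)))) ⟨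
          1# + (fromℕ (n ℕ.* 3) + e) + 1# + (N + 1#)
            -- The last of the three units is the 1 subtracted in the theorem; the other two are
            -- absorbed into 2 n, as n ≥ 1.
            ≈⟨ regroup 1# _ e N ⟩
          e + (1# + (1# + (fromℕ (n ℕ.* 3) + N))) + 1#
            ≈⟨ +-congʳ (+-congˡ (+-congˡ (+-congˡ (fromℕ-homo-+ (n ℕ.* 3) n)))) ⟨
          e + fromℕ (2 ℕ.+ (n ℕ.* 3 ℕ.+ n)) + 1#
            ≤⟨ +-monoˡ-≤ 1# (+-monoʳ-≤ e (fromℕ-mono-≤ 2+4n≤6n)) ⟩
          e + fromℕ (6 ℕ.* n) + 1# ∎
          where
          regroup : ∀ o m e n → o + (m + e) + o + (n + o) ≈ e + (o + (o + (m + n))) + o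
          regroup = solve 4 (λ o m e n → o :+ (m :+ e) :+ o :+ (n :+ o) := e :+ (o :+ (o :+ (m :+ n))) :+ o) refl
            where open Solver
          2+4n≤6n : 2 ℕ.+ (n ℕ.* 3 ℕ.+ n) ℕ.≤ 6 ℕ.* n
          2+4n≤6n = ℕₚ.≤-trans
            (ℕₚ.+-monoˡ-≤ (n ℕ.* 3 ℕ.+ n) (ℕₚ.*-monoʳ-≤ 2 1≤n))
            (ℕₚ.≤-reflexive (2n+[3n+n]≡6n n))
            where
            open +-*-Solver
            2n+[3n+n]≡6n : ∀ n → 2 ℕ.* n ℕ.+ (n ℕ.* 3 ℕ.+ n) ≡ 6 ℕ.* n
            2n+[3n+n]≡6n = solve 1 (λ n → con 2 :* n :+ (n :* con 3 :+ n) := con 6 :* n) ≡.refl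

      -- The list `L` is available only under a double negation, which is harmless because the goal
      -- is a stable inequality.
      lowerBound : lb - 1# - fromℕ (6 ℕ.* n) ≤ e
      lowerBound = ≤-stable λ ≰e →
        almostAll-common (output ∘ distinct) 0<δ (drawSequences n) λ { (L , L! , big) →
          ≰e (x≤y+z⇒x-z≤y (x≤y+z⇒x-z≤y
            (lb≤ L! (λ v → All.lookup big (∈-drawSequences v))))) }

theorem6 :
    (ℝ : CompleteOrderedField) (logarithm : BinaryLogarithm ℝ) →
    let open CompleteOrderedField ℝ
        open Filters ℝ logarithm in
    (u : ℕ) → 2 ℕ.≤ u →
    (𝒫 𝒬 : Distribution u) →
    (n : ℕ) → 1 ℕ.≤ n →
    (ε : Carrier) → 0# < ε → ε < 1# →
    (T : Pred (Subset u) 0ℓ) (T? : Decidable T) →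
    prOutside 𝒫 n T? ≤ 1# / log (fromℕ u) →
    (A : Algorithm u) →
    (∀ S → T S → IsFilter 𝒬 ε A S) →
    ∀ e → IsExpectedSize 𝒫 n A e →
    LB 𝒫 n 𝒬 ε - 1# - fromℕ (6 ℕ.* n) ≤ e
theorem6 ℝ logarithm u 2≤u 𝒫 𝒬 n 1≤n ε 0<ε ε<1 T T? rare A filters e expectedSize =
  lowerBound T T? rare filters expectedSize
  where open LowerBound.Bound logarithm 2≤u 𝒫 𝒬 1≤n 0<ε ε<1 A
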